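{- Let $D$ be a (finite, loopless) digraph and let $G$ be its underlying undirected graph. Let $\mathbf{X}_D \in \mathsf{NSym}$ be the chromatic noncommutative symmetric function of $D$, let $X_G \in \mathsf{Sym}$ be Stanley's chromatic symmetric function of $G$, and let $\chi\colon \mathsf{NSym} \to \mathsf{Sym}$ be the forgetful (commutative image) morphism. Then $$\chi(\mathbf{X}_D) = X_G.$$
   Context: Fix a field $\mathbb{k}$ of characteristic $0$. **Sym.** $\mathsf{Sym}$ is the $\mathbb{k}$-algebra of symmetric functions in commuting variables $x_1, x_2, \ldots$, i.e. $\mathsf{Sym} = \mathbb{k}[h_1,h_2,\ldots]$ where $h_n = \sum_{i_1 \le \cdots \le i_n} x_{i_1}\cdots x_{i_n}$ is the complete homogeneous symmetric function and $h_0=1$. For a partition $\lambda$, $h_\lambda = h_{\lambda_1} h_{\lambda_2}\cdots h_{\lambda_{\ell(\lambda)}}$. **NSym.** $\mathsf{NSym} = \mathbb{k}\langle H_1,H_2,\ldots\rangle$ is the free associative unital $\mathbb{k}$-algebra on noncommuting generators $H_n$ with $\deg H_n = n$. A composition is a finite tuple $\alpha = (\alpha_1,\ldots,\alpha_{\ell(\alpha)})$ of positive integers; $H_\alpha = H_{\alpha_1}\cdots H_{\alpha_{\ell(\alpha)}}$, $H_{()}=1$. For compositions $\alpha,\beta$ of the same integer, write $\beta \ge \alpha$ if $D(\beta) \subseteq D(\alpha)$, where $D(c) = \{c_1, c_1+c_2, \ldots, c_1+\cdots+c_{\ell(c)-1}\}$. The ribbon elements are $R_\alpha = \sum_{\beta\ge\alpha}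 (-1)^{\ell(\alpha)-\ell(\beta)} H_\beta$. Define $\Psi_n = \sum_{i=0}^{n-1} (-1)^i R_{(1^i,\,n-i)}$ for $n \ge 1$, where $(1^i, n-i)$ is the composition consisting of $i$ ones followed by $n-i$, and $\Psi_\alpha = \Psi_{\alpha_1}\Psi_{\alpha_2}\cdots\Psi_{\alpha_{\ell(\alpha)}}$, $\Psi_{()}=1$. **Forgetful morphism.** $\chi\colon \mathsf{NSym}\to\mathsf{Sym}$ is the linear map (an algebra morphism) with $\chi(H_\alpha) = h_{\mathrm{sort}(\alpha)}$, where $\mathrm{sort}(\alpha)$ is the partition obtained by sorting the entries of $\alpha$ into weakly decreasing order. **Chromatic symmetric function.** For a finite simple graph $G$, $X_G = \sum_{\kappa} \prod_{v\in V(G)} x_{\kappa(v)}$, summed over all proper colorings $\kappa\colon V(G)\to\{1,2,\ldots\}$ (adjacent vertices receive different colors). **Digraphs.** A digraph $D=(V(D),E(D))$ consists of a finite set $V(D)$ and a set $E(D)$ of ordered pairs (arcs) of elements of $V(D)$, with no loops. Its underlying undirected graph $G$ has vertex set $V(D)$ and edge set $\{\{u,v\} : (u,v)\in E(D)\}$. For a vertex $w$, the outdegree $\mathrm{od}\,w$ is the number of $v$ with $(w,v)\in E(D)$, and the indegree $\mathrm{id}\,w$ is the number of $v$ with $(v,w)\in E(D)$. For $W\subseteq V(D)$, the total degree (computed in all of $D$) is $\mathrm{td}\,W = \sum_{w\in W}\mathrm{od}\,w - \sum_{w\in W}\mathrm{id}\,w$. **The composition $\alpha(S)$.** Let $S\subseteq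 E(D)$ and $S' = \{\{u,v\} : (u,v)\in S\}\subseteq E(G)$. Consider the vertex sets of the connected components of the spanning subgraph $(V(D),S')$ of $G$. Fix a labeling (total order) $v_1<v_2<\cdots<v_{|V|}$ of $V = V(D)$. For two distinct components $C,C'$ put $C\rhd C'$ if: (1) $\mathrm{td}\,C>\mathrm{td}\,C'$; or (2) $\mathrm{td}\,C=\mathrm{td}\,C'$ and $|C|>|C'|$; or (3) $\mathrm{td}\,C=\mathrm{td}\,C'$, $|C|=|C'|$, and $C$ is lexicographically strictly greater than $C'$, where a vertex subset is identified with the word of its vertex indices written in increasing order. Then $\alpha(S)$ is the composition of $|V|$ listing the sizes of the components in the order given by $\rhd$, with $\rhd$-greatest component first (so components of larger total degree come first). The composition $\alpha(S)$ does not depend on the chosen labeling. **Chromatic noncommutative symmetric function.** $$\mathbf{X}_D = \sum_{S\subseteq E(D)} (-1)^{|S|}\,\Psi_{\alpha(S)} \in \mathsf{NSym}.$$ -}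

module Defs where

open import Algebra.Bundles using (CommutativeRing)
import Algebra.Properties.Semiring.Exp as SemiringExp
import Algebra.Properties.Semiring.Mult as SemiringMult
open import Data.Bool.Base using (if_then_else_)
open import Data.Fin.Base as Fin using (Fin; toℕ)
open import Data.Fin.Properties as Fin using (all?; toℕ<n)
open import Data.Integer.Base as ℤ using (ℤ; +_)
import Data.Integer.Properties as ℤ
open import Data.List.Base using (List; []; _∷_; [_]; _++_; map; concatMap; filter; foldr; length; upTo; allFin; replicate; deduplicate; cartesianProduct; cartesianProductWith)
open import Data.List.Membership.Propositional using (_∈_; mapWith∈)
open import Data.List.Membership.Propositional.Properties using (∈-allFin; ∈-filter⁺; ∈-map⁻; ∈-deduplicate⁻)
import Data.List.Properties as List
open import Data.List.Relation.Binary.Lex.Strict using (<-strictTotalOrder)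
open import Data.List.Relation.Binary.Permutation.Propositional.Properties using (∈-resp-↭)
import Data.List.Relation.Binary.Subset.DecPropositional as DecSubset
open import Data.List.Relation.Binary.Subset.Propositional using (_⊆_)
open import Data.List.Relation.Unary.Any using (here; there)
import Data.List.Relation.Unary.Sorted.TotalOrder as Sorted
import Data.List.Sort as Sort
open import Data.Nat.Base using (ℕ; zero; suc; _+_; _∸_; NonZero; >-nonZero)
open import Data.Nat.ListAction using (sum)
import Data.Nat.Properties as ℕ
open import Data.Product.Base using (∃-syntax; _×_; _,_)
open import Data.Product.Relation.Binary.Lex.Strict using (×-strictTotalOrder)
open import Data.Sum.Base using (_⊎_; inj₁; inj₂; swap)
open import Data.Vec.Base as Vec using (Vec)
open import Data.Vec.Relation.Unary.Linked using (Linked; linked?)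
open import Function.Base using (_∘_)
open import Level using (_⊔_; 0ℓ) renaming (suc to lsuc)
open import Relation.Binary.Bundles using (StrictTotalOrder; DecTotalOrder)
open import Relation.Binary.Construct.Closure.Equivalence as Eq using (EqClosure)
open import Relation.Binary.Construct.Closure.ReflexiveTransitive using (ε; _◅_; _◅◅_)
open import Relation.Binary.Construct.Closure.Symmetric using (fwd; bwd)
import Relation.Binary.Construct.Flip.EqAndOrd as Flip
import Relation.Binary.Construct.On as On
open import Relation.Binary.Core using (Rel)
open import Relation.Binary.Definitions using (Decidable; Irreflexive; Symmetric)
import Relation.Binary.Properties.StrictTotalOrder as StrictTotalOrderProperties
open import Relation.Binary.PropositionalEquality using (_≡_; _≢_; refl)
open import Relation.Nullary.Decidable using (Dec; does; map′; _×-dec_; _⊎-dec_; _→-dec_; ¬?)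
open import Relation.Nullary.Negation using (¬_)

------------------------------------------------------------------------
-- Fields

record Field c ℓ : Set (lsuc (c ⊔ ℓ)) where
  field
    commutativeRing : CommutativeRing c ℓ
  open CommutativeRing commutativeRing public
  field
    1≉0     : ¬ (1# ≈ 0#)
    inverse : ∀ x → ¬ (x ≈ 0#) → ∃[ y ] (x * y ≈ 1#)

CharacteristicZero : ∀ {c ℓ} → Field c ℓ → Set ℓ
CharacteristicZero 𝕜 = ∀ n .{{_ : NonZero n}} → ¬ (n · 1# ≈ 0#)
  where
  open Field 𝕜
  open SemiringMult semiring renaming (_×_ to _·_)

------------------------------------------------------------------------
-- Finite enumerations

-- The sublists of a duplicate-free list enumerate the subsets of its
-- set of entries, each once.
sublists : ∀ {a} {A : Set a} → List A → List (List A)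
sublists []       = [ [] ]
sublists (x ∷ xs) = sublists xs ++ map (x ∷_) (sublists xs)

words : ∀ {a} {A : Set a} → List A → (n : ℕ) → List (Vec A n)
words xs zero    = [ Vec.[] ]
words xs (suc n) = cartesianProductWith Vec._∷_ xs (words xs n)

------------------------------------------------------------------------
-- Compositions and partitions

record ℕ⁺ : Set where
  constructor pos
  field
    value        : ℕ
    .{{nonZero}} : NonZero value
open ℕ⁺ public using (value)

Composition : Set
Composition = List ℕ⁺

∣_∣ᶜ : Composition → ℕ
∣ α ∣ᶜ = sum (map value α)

-- D(α)
descents : Composition → List ℕ
descents []          = []
descents (_ ∷ [])    = []
descents (a ∷ b ∷ α) = value a ∷ map (λ d → value a + d) (descents (b ∷ α))

-- The compositions of a + n with first part at least a.
compositionsFrom : (a : ℕ) .{{_ : NonZero a}} → ℕ → List Composition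
compositionsFrom a zero    = [ [ pos a ] ]
compositionsFrom a (suc n) = map (pos a ∷_) (compositionsFrom 1 n) ++ compositionsFrom (suc a) n

compositions : ℕ → List Composition
compositions zero    = [ [] ]
compositions (suc n) = compositionsFrom 1 n

_≥ᶜ_ : Composition → Composition → Set
β ≥ᶜ α = ∣ β ∣ᶜ ≡ ∣ α ∣ᶜ × descents β ⊆ descents α

_≥ᶜ?_ : Decidable _≥ᶜ_
β ≥ᶜ? α = (∣ β ∣ᶜ ℕ.≟ ∣ α ∣ᶜ) ×-dec (descents β ⊆? descents α)
  where open DecSubset ℕ._≟_

≥-decTotalOrder : DecTotalOrder 0ℓ 0ℓ 0ℓ
≥-decTotalOrder = Flip.decTotalOrder (On.decTotalOrder ℕ.≤-decTotalOrder value)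

record Partition : Set where
  field
    parts            : Composition
    weaklyDecreasing : Sorted.Sorted (DecTotalOrder.totalOrder ≥-decTotalOrder) parts
open Partition public using (parts)

sort : Composition → Partition
sort α = record { parts = S.sort α ; weaklyDecreasing = S.sort-↗ α }
  where module S = Sort ≥-decTotalOrder

------------------------------------------------------------------------
-- Graphs and digraphs

record Graph : Set₁ where
  field
    order    : ℕ
    _~_      : Rel (Fin order) 0ℓ
    _~?_     : Decidable _~_
    ~-sym    : Symmetric _~_
    ~-irrefl : Irreflexive _≡_ _~_

record Digraph : Set₁ where
  field
    order    : ℕ
    _⟶_      : Rel (Fin order) 0ℓ
    _⟶?_     : Decidable _⟶_
    ⟶-irrefl : Irreflexive _≡_ _⟶_

underlying : Digraph → Graph
underlying D = record
  { order    = order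
  ; _~_      = λ u v → (u ⟶ v) ⊎ (v ⟶ u)
  ; _~?_     = λ u v → (u ⟶? v) ⊎-dec (v ⟶? u)
  ; ~-sym    = swap
  ; ~-irrefl = λ { refl (inj₁ uu) → ⟶-irrefl refl uu ; refl (inj₂ uu) → ⟶-irrefl refl uu }
  }
  where open Digraph D

------------------------------------------------------------------------
-- Connectivity

-- u and v lie in the same component of the spanning subgraph whose edges
-- are the arcs in S with their orientation forgotten.
Connected : ∀ {n} → List (Fin n × Fin n) → Rel (Fin n) 0ℓ
Connected S = EqClosure (λ u v → (u , v) ∈ S)

module _ {n} {a b : Fin n} {S : List (Fin n × Fin n)} where

  private
    Via : Rel (Fin n) 0ℓ
    Via u v = Connected S u v ⊎ (Connected S u a × Connected S b v) ⊎ (Connected S u b × Connected S a v)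

  connected-∷⁻ : ∀ {u v} → Connected ((a , b) ∷ S) u v → Via u v
  connected-∷⁻ ε = inj₁ ε
  connected-∷⁻ (fwd (here refl) ◅ p) with connected-∷⁻ p
  ... | inj₁ b~v              = inj₂ (inj₁ (ε , b~v))
  ... | inj₂ (inj₁ (_ , b~v)) = inj₂ (inj₁ (ε , b~v))
  ... | inj₂ (inj₂ (_ , a~v)) = inj₁ a~v
  connected-∷⁻ (bwd (here refl) ◅ p) with connected-∷⁻ p
  ... | inj₁ a~v              = inj₂ (inj₂ (ε , a~v))
  ... | inj₂ (inj₁ (_ , b~v)) = inj₁ b~v
  ... | inj₂ (inj₂ (_ , a~v)) = inj₂ (inj₂ (ε , a~v))
  connected-∷⁻ (fwd (there e) ◅ p) with connected-∷⁻ p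
  ... | inj₁ q              = inj₁ (fwd e ◅ q)
  ... | inj₂ (inj₁ (q , r)) = inj₂ (inj₁ (fwd e ◅ q , r))
  ... | inj₂ (inj₂ (q , r)) = inj₂ (inj₂ (fwd e ◅ q , r))
  connected-∷⁻ (bwd (there e) ◅ p) with connected-∷⁻ p
  ... | inj₁ q              = inj₁ (bwd e ◅ q)
  ... | inj₂ (inj₁ (q , r)) = inj₂ (inj₁ (bwd e ◅ q , r))
  ... | inj₂ (inj₂ (q , r)) = inj₂ (inj₂ (bwd e ◅ q , r))

  connected-∷⁺ : ∀ {u v} → Via u v → Connected ((a , b) ∷ S) u v
  connected-∷⁺ (inj₁ p)              = Eq.map there p
  connected-∷⁺ (inj₂ (inj₁ (p , q))) = Eq.map there p ◅◅ fwd (here refl) ◅ Eq.map there q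
  connected-∷⁺ (inj₂ (inj₂ (p , q))) = Eq.map there p ◅◅ bwd (here refl) ◅ Eq.map there q

connected? : ∀ {n} (S : List (Fin n × Fin n)) → Decidable (Connected S)
connected? []            u v = map′ (λ { refl → ε }) (λ { ε → refl ; (fwd () ◅ _) ; (bwd () ◅ _) }) (u Fin.≟ v)
connected? ((a , b) ∷ S) u v = map′ connected-∷⁺ connected-∷⁻
  (connected? S u v ⊎-dec ((connected? S u a ×-dec connected? S b v) ⊎-dec (connected? S u b ×-dec connected? S a v)))

-- A vertex set is represented by the list of its elements in increasing
-- order, that is, by the word used for lexicographic comparison.
component : ∀ {n} → List (Fin n × Fin n) → Fin n → List (Fin n)
component S v = filter (connected? S v) (allFin _)

components : ∀ {n} → List (Fin n × Fin n) → List (List (Fin n))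
components S = deduplicate (List.≡-dec Fin._≟_) (map (component S) (allFin _))

------------------------------------------------------------------------
-- The composition α(S)

module _ (D : Digraph) where
  open Digraph D

  arcs : List (Fin order × Fin order)
  arcs = filter (λ (u , v) → u ⟶? v) (cartesianProduct (allFin order) (allFin order))

  outdegree indegree : Fin order → ℕ
  outdegree w = length (filter (λ v → w ⟶? v) (allFin order))
  indegree  w = length (filter (λ v → v ⟶? w) (allFin order))

  totalDegree : List (Fin order) → ℤ
  totalDegree W = + sum (map outdegree W) ℤ.- + sum (map indegree W)

  -- C ▷ C′ if and only if C′ precedes C in the lexicographic comparison
  -- of total degree, then size, then word.
  ▷-strictTotalOrder : StrictTotalOrder 0ℓ 0ℓ 0ℓ
  ▷-strictTotalOrder = Flip.strictTotalOrder (On.strictTotalOrder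
    (×-strictTotalOrder ℤ.<-strictTotalOrder
      (×-strictTotalOrder ℕ.<-strictTotalOrder
        (<-strictTotalOrder (Fin.<-strictTotalOrder order))))
    (λ C → totalDegree C , length C , C))

  private
    module ▷-Sort = Sort (StrictTotalOrderProperties.decTotalOrder ▷-strictTotalOrder)

  -- Sorting upwards for the reflexive closure of ▷ puts the ▷-greatest
  -- component first.
  sortedComponents : List (Fin order × Fin order) → List (List (Fin order))
  sortedComponents S = ▷-Sort.sort (components S)

  sortedComponents-nonempty : ∀ S {C} → C ∈ sortedComponents S → NonZero (length C)
  sortedComponents-nonempty S C∈
    with v , _ , refl ← ∈-map⁻ (component S)
           (∈-deduplicate⁻ (List.≡-dec Fin._≟_) (map (component S) (allFin order))
             (∈-resp-↭ (▷-Sort.sort-↭ (components S)) C∈))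
    = inhabited (∈-filter⁺ (connected? S v) (∈-allFin v) ε)
    where
    inhabited : ∀ {v : Fin order} {C} → v ∈ C → NonZero (length C)
    inhabited (here _)  = _
    inhabited (there _) = _

  α : List (Fin order × Fin order) → Composition
  α S = mapWith∈ (sortedComponents S) (λ {C} C∈ → pos (length C) {{sortedComponents-nonempty S C∈}})

------------------------------------------------------------------------
-- Sym, NSym and the chromatic functions

module OverField {c ℓ} (𝕜 : Field c ℓ) where
  open Field 𝕜 using (Carrier; _≈_; 0#; 1#; -_; semiring) renaming (_+_ to _+ᴷ_; _*_ to _*ᴷ_)
  open SemiringMult semiring using () renaming (_×_ to _·_)
  open SemiringExp semiring using () renaming (_^_ to _^ᴷ_)

  [-1]^_ : ℕ → Carrier
  [-1]^ n = (- 1#) ^ᴷ n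

  -- Formal linear combinations of elements of B; two lists with the same
  -- coefficient at every basis element denote the same combination.
  Span : Set → Set c
  Span B = List (Carrier × B)

  module _ {B : Set} where

    basis : B → Span B
    basis b = [ 1# , b ]

    infixr 7 _•_
    _•_ : Carrier → Span B → Span B
    k • x = map (λ (l , b) → k *ᴷ l , b) x

    ∑-syntax : ∀ {a} {A : Set a} → List A → (A → Span B) → Span B
    ∑-syntax xs f = concatMap f xs

    infix 4 ∑-syntax
    syntax ∑-syntax xs (λ x → e) = ∑[ x ∈ xs ] e

  linear : ∀ {A B} → (A → Span B) → Span A → Span B
  linear f x = concatMap (λ (k , a) → k • f a) x

  -- The free algebra 𝕜⟨H₁, H₂, …⟩, with basis the words H_α.
  NSym : Set c
  NSym = Span Composition

  H : Composition → NSym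
  H = basis

  1ᴺ : NSym
  1ᴺ = H []

  infixl 7 _*ᴺ_
  _*ᴺ_ : NSym → NSym → NSym
  _*ᴺ_ = cartesianProductWith (λ (k , α) (l , β) → k *ᴷ l , α ++ β)

  -- The truncated subtraction is exact: β ≥ α forces length β ≤ length α.
  R : Composition → NSym
  R α = ∑[ β ∈ filter (_≥ᶜ? α) (compositions ∣ α ∣ᶜ) ] [-1]^ (length α ∸ length β) • H β

  -- (1ⁱ, n - i)
  hook : (n : ℕ) → Fin n → Composition
  hook n i = replicate (toℕ i) (pos 1) ++ [ pos (n ∸ toℕ i) {{>-nonZero (ℕ.m<n⇒0<n∸m (toℕ<n i))}} ]

  Ψ : ℕ⁺ → NSym
  Ψ (pos n) = ∑[ i ∈ allFin n ] [-1]^ (toℕ i) • R (hook n i)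

  Ψᶜ : Composition → NSym
  Ψᶜ = foldr (λ a x → Ψ a *ᴺ x) 1ᴺ

  𝐗 : Digraph → NSym
  𝐗 D = ∑[ S ∈ sublists (arcs D) ] [-1]^ (length S) • Ψᶜ (α D S)

  -- The polynomial algebra 𝕜[h₁, h₂, …], with basis the monomials h_λ.
  Sym : Set c
  Sym = Span Partition

  h : Partition → Sym
  h = basis

  χ : NSym → Sym
  χ = linear (h ∘ sort)

  -- (e₁, …, eₘ) stands for the monomial x₁^e₁ ⋯ xₘ^eₘ, so trailing zeros
  -- are immaterial.
  Monomial : Set
  Monomial = List ℕ

  -- Formal power series in x₁, x₂, …, given by their coefficients.
  Series : Set c
  Series = Monomial → Carrier

  infix 4 _≈ˢ_
  _≈ˢ_ : Series → Series → Set ℓ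
  f ≈ˢ g = ∀ e → f e ≈ g e

  ∑ᴷ : List Carrier → Carrier
  ∑ᴷ = foldr _+ᴷ_ 0#

  factorizations : Monomial → List (Monomial × Monomial)
  factorizations []      = [ [] , [] ]
  factorizations (n ∷ e) = cartesianProductWith (λ i (a , b) → i ∷ a , (n ∸ i) ∷ b) (upTo (suc n)) (factorizations e)

  1ˢ : Series
  1ˢ e = if does (sum e ℕ.≟ 0) then 1# else 0#

  infixl 7 _*ˢ_
  _*ˢ_ : Series → Series → Series
  (f *ˢ g) e = ∑ᴷ (map (λ (a , b) → f a *ᴷ g b) (factorizations e))

  -- x_{w₁} ⋯ x_{wₙ}
  monomial : ∀ {m n} → Vec (Fin m) n → Monomial
  monomial {m} w = map (λ i → Vec.count (i Fin.≟_) w) (allFin m)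

  -- The sum of x_{w₁} ⋯ x_{wₙ} over all w satisfying P.  A word w that
  -- contributes to x₁^e₁ ⋯ xₘ^eₘ only uses the indices 1, …, m, so the
  -- coefficient counts words over Fin m.
  sumOfMonomials : (n : ℕ) {P : ∀ {m} → Vec (Fin m) n → Set} → (∀ {m} (w : Vec (Fin m) n) → Dec (P w)) → Series
  sumOfMonomials n P? e =
    length (filter (λ w → P? w ×-dec List.≡-dec ℕ._≟_ (monomial w) e) (words (allFin (length e)) n)) · 1#

  hˢ : ℕ → Series
  hˢ n = sumOfMonomials n {Linked Fin._≤_} (linked? Fin._≤?_)

  -- A polynomial in h₁, h₂, … as a power series in x₁, x₂, ….
  ⟦_⟧ : Sym → Series
  ⟦ x ⟧ e = ∑ᴷ (map (λ (k , p) → k *ᴷ foldr (λ n f → hˢ (value n) *ˢ f) 1ˢ (parts p) e) x)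

  module _ (G : Graph) where
    open Graph G

    Proper : ∀ {m} → Vec (Fin m) order → Set
    Proper κ = ∀ u v → u ~ v → Vec.lookup κ u ≢ Vec.lookup κ v

    proper? : ∀ {m} (κ : Vec (Fin m) order) → Dec (Proper κ)
    proper? κ = all? (λ u → all? (λ v → (u ~? v) →-dec ¬? (Vec.lookup κ u Fin.≟ Vec.lookup κ v)))

    X : Series
    X = sumOfMonomials order {Proper} proper?

{-# OPTIONS --safe #-}
module Submission where

-- Let φ : NSym → Series send H_α to the product of the h_{αᵢ}.  Since h's commute,
-- φ is multiplicative and equals χ followed by the embedding of Sym.  Collecting the
-- ribbons of Ψₙ gives Ψₙ = Σ_{β ⊨ n} (-1)^(ℓ(β)-1) last(β) H_β, which Newton's
-- identities identify with the power sum pₙ under φ.  Hence φ(Ψ_{α(S)}), whatever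
-- the order of the parts, is the sum over colourings that are constant on the
-- components of S, i.e. monochromatic on every arc of S, and summing with the signs
-- (-1)^|S| over all sets S of arcs is inclusion–exclusion for proper colourings.
-- Antiparallel arcs are harmless: they impose the same condition twice.

open import Defs

open import Algebra.Bundles using (CommutativeSemiring)
import Algebra.Properties.CommutativeSemigroup as CommutativeSemigroupProperties
import Algebra.Properties.Ring as RingProperties
import Algebra.Properties.Semiring.Exp as SemiringExp
import Algebra.Properties.Semiring.Mult as SemiringMult
open import Data.Bool.Base using (if_then_else_; true; false)
open import Data.Fin.Base as Fin using (Fin; zero; suc; toℕ)
import Data.Fin.Properties as Fin
open import Data.List.Base using (List; []; _∷_; _++_; map; concatMap; filter; foldr; length; upTo; applyUpTo; allFin; tabulate; replicate; cartesianProduct; cartesianProductWith; lookup)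
open import Data.List.Membership.Propositional using (_∈_)
open import Data.List.Membership.Propositional.Properties
open import Data.List.Membership.Propositional.Properties.WithK using (unique∧set⇒bag)
import Data.List.Properties as List
open import Data.List.Relation.Binary.BagAndSetEquality using (∼bag⇒↭)
open import Data.List.Relation.Binary.Permutation.Propositional using (_↭_; prep; swap; ↭-sym; ↭⇒↭ₛ)
import Data.List.Relation.Binary.Permutation.Propositional as ↭
open import Data.List.Relation.Binary.Permutation.Propositional.Properties using (∈-resp-↭)
import Data.List.Relation.Binary.Permutation.Setoid.Properties as ↭ₛ
open import Data.List.Relation.Unary.All as All using (All; []; _∷_)
import Data.List.Relation.Unary.All.Properties as All
open import Data.List.Relation.Unary.AllPairs using ([]; _∷_)
open import Data.List.Relation.Unary.Any as Any using (here; there)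
open import Data.List.Relation.Unary.Any.Properties using (lookup-index)
open import Data.List.Relation.Unary.Unique.Propositional using (Unique)
import Data.List.Relation.Unary.Unique.DecPropositional.Properties as UniqueDec
import Data.List.Relation.Unary.Unique.Propositional.Properties as Unique
import Data.List.Sort as Sort
open import Data.Nat.Base as ℕ using (ℕ; zero; suc; _≤_; _∸_; z≤n; s≤s; NonZero)
open import Data.Nat.ListAction using (sum)
import Data.Nat.Properties as ℕ
open import Data.Product.Base using (∃-syntax; _×_; _,_; proj₁; proj₂; uncurry)
open import Data.Sum.Base using (inj₁; inj₂; [_,_]′)
open import Data.Vec.Base as Vec using (Vec; []; _∷_)
import Data.Vec.Properties as Vec
open import Data.Vec.Relation.Unary.Linked as Linked using (Linked; linked?; []; [-]; _∷_)
open import Function.Base using (_∘_; id; flip)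
open import Function.Bundles using (mk⇔)
open import Level using (Level)
open import Relation.Binary.Construct.Closure.Equivalence as Eq using ()
import Relation.Binary.Properties.StrictTotalOrder as StrictTotalOrderProperties
open import Relation.Binary.PropositionalEquality as ≡ using (_≡_; _≢_; refl; cong; cong₂)
open import Relation.Nullary.Decidable as Dec using (Dec; yes; no; does; dec-true; dec-false; does-⇔; _×-dec_; ¬?)
open import Relation.Binary.Construct.Closure.ReflexiveTransitive using (ε; _◅◅_)
open import Relation.Binary.Definitions using (tri<; tri≈; tri>)
open import Relation.Nullary.Negation using (¬_; contradiction)
open import Relation.Unary using (Pred; Decidable)

-- Identities in `Sym` are tested coefficientwise. The coefficient at an exponent list `e` involves
-- only `length e` variables, so each assertion becomes one about finite sums over words,
-- compositions or colourings. Two descriptions keep these sums explicit: `h_n` has coefficient 1 at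
-- every monomial of degree n, and multiplication by `p_k` moves k units of one exponent. The
-- alternating sum over the compositions of n does not recur by itself: enumerating them by first
-- part leads to compositions whose first part is bounded below. The induction therefore treats
-- compositions of a + n with first part at least a, whose signed sum is Σ_{b<a} h_b p_{a+n-b}. At n
-- = 0 this is Newton's identity for a h_a, which starts the induction; at a = 1 it is p_{n+1}, the
-- value wanted.

private
  variable
    a b p q : Level
    A B C : Set a

-- Finite sums and convolutions in a commutative semiring

module ListSum {c ℓ} (R : CommutativeSemiring c ℓ) where
  open CommutativeSemiring R renaming (refl to ≈-refl; sym to ≈-sym; trans to ≈-trans; zero to *-zero)
  open CommutativeSemigroupProperties +-commutativeSemigroup using (interchange; x∙yz≈y∙xz)
  open import Relation.Binary.Reasoning.Setoid setoid

  ∑ : List A → (A → Carrier) → Carrier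
  ∑ xs f = foldr _+_ 0# (map f xs)

  -- Branching on `does` alone makes the indicator independent of the proof inside the decision, and
  -- lets it reduce as soon as the Boolean does. In particular `1ˢ e` is by definition
  -- `𝟙 (sum e ℕ.≟ 0)`.
  𝟙 : {P : Set p} → Dec P → Carrier
  𝟙 P? = if does P? then 1# else 0#

  𝟙-yes : {P : Set p} (P? : Dec P) → P → 𝟙 P? ≈ 1#
  𝟙-yes P? x rewrite dec-true P? x = ≈-refl

  𝟙-no : {P : Set p} (P? : Dec P) → ¬ P → 𝟙 P? ≈ 0#
  𝟙-no P? x rewrite dec-false P? x = ≈-refl

  𝟙-⇔ : {P : Set p} {Q : Set q} (P? : Dec P) (Q? : Dec Q) → (P → Q) → (Q → P) → 𝟙 P? ≈ 𝟙 Q?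
  𝟙-⇔ P? Q? f g rewrite does-⇔ (mk⇔ f g) P? Q? = ≈-refl

  𝟙-× : {P : Set p} {Q : Set q} (P? : Dec P) (Q? : Dec Q) → 𝟙 (P? ×-dec Q?) ≈ 𝟙 P? * 𝟙 Q?
  𝟙-× (true  Dec.because _) Q? = ≈-sym (*-identityˡ _)
  𝟙-× (false Dec.because _) Q? = ≈-sym (zeroˡ _)

  ∑-cong∈ : (xs : List A) {f g : A → Carrier} → (∀ {x} → x ∈ xs → f x ≈ g x) → ∑ xs f ≈ ∑ xs g
  ∑-cong∈ []       eq = ≈-refl
  ∑-cong∈ (x ∷ xs) eq = +-cong (eq (here refl)) (∑-cong∈ xs (eq ∘ there))

  ∑-cong : (xs : List A) {f g : A → Carrier} → (∀ x → f x ≈ g x) → ∑ xs f ≈ ∑ xs g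
  ∑-cong xs eq = ∑-cong∈ xs (λ {x} _ → eq x)

  ∑-++ : (xs ys : List A) (f : A → Carrier) → ∑ (xs ++ ys) f ≈ ∑ xs f + ∑ ys f
  ∑-++ []       ys f = ≈-sym (+-identityˡ _)
  ∑-++ (x ∷ xs) ys f = ≈-trans (+-congˡ (∑-++ xs ys f)) (≈-sym (+-assoc _ _ _))

  ∑-map : (g : A → B) (xs : List A) (f : B → Carrier) → ∑ (map g xs) f ≈ ∑ xs (f ∘ g)
  ∑-map g []       f = ≈-refl
  ∑-map g (x ∷ xs) f = +-congˡ (∑-map g xs f)

  ∑-concatMap : (g : A → List B) (xs : List A) (f : B → Carrier) → ∑ (concatMap g xs) f ≈ ∑ xs (λ x → ∑ (g x) f)
  ∑-concatMap g []       f = ≈-refl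
  ∑-concatMap g (x ∷ xs) f = ≈-trans (∑-++ (g x) _ f) (+-congˡ (∑-concatMap g xs f))

  ∑-cartesianProductWith : (g : A → B → C) (xs : List A) (ys : List B) (f : C → Carrier) →
    ∑ (cartesianProductWith g xs ys) f ≈ ∑ xs (λ x → ∑ ys (λ y → f (g x y)))
  ∑-cartesianProductWith g []       ys f = ≈-refl
  ∑-cartesianProductWith g (x ∷ xs) ys f =
    ≈-trans (∑-++ (map (g x) ys) _ f) (+-cong (∑-map (g x) ys f) (∑-cartesianProductWith g xs ys f))

  ∑-0 : (xs : List A) → ∑ xs (λ _ → 0#) ≈ 0#
  ∑-0 []       = ≈-refl
  ∑-0 (x ∷ xs) = ≈-trans (+-identityˡ _) (∑-0 xs)

  ∑-+ : (xs : List A) (f g : A → Carrier) → ∑ xs (λ x → f x + g x) ≈ ∑ xs f + ∑ xs g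
  ∑-+ []       f g = ≈-sym (+-identityˡ _)
  ∑-+ (x ∷ xs) f g = ≈-trans (+-congˡ (∑-+ xs f g)) (interchange _ _ _ _)

  *-∑ : (k : Carrier) (xs : List A) (f : A → Carrier) → k * ∑ xs f ≈ ∑ xs (λ x → k * f x)
  *-∑ k []       f = zeroʳ k
  *-∑ k (x ∷ xs) f = ≈-trans (distribˡ _ _ _) (+-congˡ (*-∑ k xs f))

  ∑-* : (k : Carrier) (xs : List A) (f : A → Carrier) → ∑ xs f * k ≈ ∑ xs (λ x → f x * k)
  ∑-* k []       f = zeroˡ k
  ∑-* k (x ∷ xs) f = ≈-trans (distribʳ _ _ _) (+-congˡ (∑-* k xs f))

  ∑-swap : (xs : List A) (ys : List B) (f : A → B → Carrier) →
    ∑ xs (λ x → ∑ ys (f x)) ≈ ∑ ys (λ y → ∑ xs (λ x → f x y))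
  ∑-swap []       ys f = ≈-sym (∑-0 ys)
  ∑-swap (x ∷ xs) ys f = ≈-trans (+-congˡ (∑-swap xs ys f)) (≈-sym (∑-+ ys (f x) _))

  ∑-filter : {P : Pred A p} (P? : Decidable P) (xs : List A) (f : A → Carrier) →
    ∑ (filter P? xs) f ≈ ∑ xs (λ x → 𝟙 (P? x) * f x)
  ∑-filter P? []       f = ≈-refl
  ∑-filter P? (x ∷ xs) f with does (P? x)
  ... | true  = +-cong (≈-sym (*-identityˡ _)) (∑-filter P? xs f)
  ... | false = begin
    ∑ (filter P? xs) f                      ≈⟨ ∑-filter P? xs f ⟩
    ∑ xs (λ x → 𝟙 (P? x) * f x)             ≈⟨ +-identityˡ _ ⟨
    0# + ∑ xs (λ x → 𝟙 (P? x) * f x)        ≈⟨ +-congʳ (zeroˡ _) ⟨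
    0# * f x + ∑ xs (λ x → 𝟙 (P? x) * f x)  ∎

  ∑-↭ : {xs ys : List A} (f : A → Carrier) → xs ↭ ys → ∑ xs f ≈ ∑ ys f
  ∑-↭ f ↭.refl          = ≈-refl
  ∑-↭ f (prep x r)      = +-congˡ (∑-↭ f r)
  ∑-↭ f (swap x y r)    = ≈-trans (x∙yz≈y∙xz _ _ _) (+-congˡ (+-congˡ (∑-↭ f r)))
  ∑-↭ f (↭.trans r s)   = ≈-trans (∑-↭ f r) (∑-↭ f s)

  ∑-applyUpTo : (g : ℕ → A) (n : ℕ) (f : A → Carrier) → ∑ (applyUpTo g n) f ≈ ∑ (upTo n) (f ∘ g)
  ∑-applyUpTo g n f = reflexive (cong (foldr _+_ 0#)
    (≡.trans (List.map-applyUpTo g f n) (≡.sym (List.map-upTo (f ∘ g) n))))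

  ∑-tabulate : ∀ {n} (g : Fin n → A) (f : A → Carrier) → ∑ (tabulate g) f ≈ ∑ (allFin n) (f ∘ g)
  ∑-tabulate g f = reflexive (cong (foldr _+_ 0#)
    (≡.trans (List.map-tabulate g f) (≡.sym (List.map-tabulate id (f ∘ g)))))

  ∑-upTo-suc : (n : ℕ) (f : ℕ → Carrier) → ∑ (upTo (suc n)) f ≈ f 0 + ∑ (upTo n) (f ∘ suc)
  ∑-upTo-suc n f = +-congˡ (∑-applyUpTo suc n f)

  ∑-allFin-suc : (n : ℕ) (f : Fin (suc n) → Carrier) → ∑ (allFin (suc n)) f ≈ f zero + ∑ (allFin n) (f ∘ suc)
  ∑-allFin-suc n f = +-congˡ (∑-tabulate suc f)

  ∑-allFin-toℕ : (n : ℕ) (f : ℕ → Carrier) → ∑ (allFin n) (f ∘ toℕ) ≈ ∑ (upTo n) f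
  ∑-allFin-toℕ zero    f = ≈-refl
  ∑-allFin-toℕ (suc n) f = begin
    ∑ (allFin (suc n)) (f ∘ toℕ)           ≈⟨ ∑-allFin-suc n (f ∘ toℕ) ⟩
    f 0 + ∑ (allFin n) (f ∘ suc ∘ toℕ)     ≈⟨ +-congˡ (∑-allFin-toℕ n (f ∘ suc)) ⟩
    f 0 + ∑ (upTo n) (f ∘ suc)             ≈⟨ ∑-upTo-suc n f ⟨
    ∑ (upTo (suc n)) f                     ∎

  ∑-𝟙≟ : ∀ {n} (i : Fin n) (f : Fin n → Carrier) → ∑ (allFin n) (λ j → 𝟙 (i Fin.≟ j) * f j) ≈ f i
  ∑-𝟙≟ {suc n} zero f = begin
    ∑ (allFin (suc n)) (λ j → 𝟙 (zero Fin.≟ j) * f j)  ≈⟨ ∑-allFin-suc n (λ j → 𝟙 (zero Fin.≟ j) * f j) ⟩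
    1# * f zero + ∑ (allFin n) (λ j → 0# * f (suc j))  ≈⟨ +-cong (*-identityˡ _) (≈-trans (∑-cong (allFin n) (λ _ → zeroˡ _)) (∑-0 (allFin n))) ⟩
    f zero + 0#                                        ≈⟨ +-identityʳ _ ⟩
    f zero                                             ∎
  ∑-𝟙≟ {suc n} (suc i) f = begin
    ∑ (allFin (suc n)) (λ j → 𝟙 (suc i Fin.≟ j) * f j)                     ≈⟨ ∑-allFin-suc n (λ j → 𝟙 (suc i Fin.≟ j) * f j) ⟩
    0# * f zero + ∑ (allFin n) (λ j → 𝟙 (suc i Fin.≟ suc j) * f (suc j))  ≈⟨ +-cong (zeroˡ _) (∑-cong (allFin n) (λ j → *-congʳ (𝟙-⇔ (suc i Fin.≟ suc j) (i Fin.≟ j) Fin.suc-injective (cong suc)))) ⟩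
    0# + ∑ (allFin n) (λ j → 𝟙 (i Fin.≟ j) * f (suc j))                    ≈⟨ +-identityˡ _ ⟩
    ∑ (allFin n) (λ j → 𝟙 (i Fin.≟ j) * f (suc j))                         ≈⟨ ∑-𝟙≟ i (f ∘ suc) ⟩
    f (suc i)                                                              ∎

  -- This is Σ f i j over i + j = n. Carrying both indices lets the recursion peel off one term
  -- without truncated subtraction; `∑-antidiagonal` relates it to the form with `n ∸ i`.
  antidiagonal : ℕ → (ℕ → ℕ → Carrier) → Carrier
  antidiagonal zero    f = f 0 0
  antidiagonal (suc n) f = f 0 (suc n) + antidiagonal n (λ i j → f (suc i) j)

  antidiagonal-cong : ∀ n {f g : ℕ → ℕ → Carrier} → (∀ i j → f i j ≈ g i j) → antidiagonal n f ≈ antidiagonal n g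
  antidiagonal-cong zero    eq = eq 0 0
  antidiagonal-cong (suc n) eq = +-cong (eq 0 (suc n)) (antidiagonal-cong n (λ i j → eq (suc i) j))

  antidiagonal-+ : ∀ n (f g : ℕ → ℕ → Carrier) →
    antidiagonal n (λ i j → f i j + g i j) ≈ antidiagonal n f + antidiagonal n g
  antidiagonal-+ zero    f g = ≈-refl
  antidiagonal-+ (suc n) f g = ≈-trans (+-congˡ (antidiagonal-+ n _ _)) (interchange _ _ _ _)

  antidiagonal-0 : ∀ n → antidiagonal n (λ _ _ → 0#) ≈ 0#
  antidiagonal-0 zero    = ≈-refl
  antidiagonal-0 (suc n) = ≈-trans (+-identityˡ _) (antidiagonal-0 n)

  antidiagonal-∑ : ∀ n (xs : List A) (f : ℕ → ℕ → A → Carrier) →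
    antidiagonal n (λ i j → ∑ xs (f i j)) ≈ ∑ xs (λ x → antidiagonal n (λ i j → f i j x))
  antidiagonal-∑ n []       f = antidiagonal-0 n
  antidiagonal-∑ n (x ∷ xs) f = ≈-trans (antidiagonal-+ n (λ i j → f i j x) _) (+-congˡ (antidiagonal-∑ n xs f))

  antidiagonal-last : ∀ n (f : ℕ → ℕ → Carrier) →
    antidiagonal (suc n) f ≈ f (suc n) 0 + antidiagonal n (λ i j → f i (suc j))
  antidiagonal-last zero    f = +-comm _ _
  antidiagonal-last (suc n) f = ≈-trans (+-congˡ (antidiagonal-last n (λ i j → f (suc i) j))) (x∙yz≈y∙xz _ _ _)

  antidiagonal-flip : ∀ n (f : ℕ → ℕ → Carrier) → antidiagonal n f ≈ antidiagonal n (flip f)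
  antidiagonal-flip zero    f = ≈-refl
  antidiagonal-flip (suc n) f =
    ≈-trans (+-congˡ (antidiagonal-flip n (λ i j → f (suc i) j))) (≈-sym (antidiagonal-last n (flip f)))

  -- Both sides run over i + j + k = n. The step collects the terms with i = 0 into
  -- `antidiagonal (suc n) (f 0)` and applies induction to those with i ≥ 1. This is the
  -- one-variable core of associativity for power series.
  antidiagonal-assoc : ∀ n (f : ℕ → ℕ → ℕ → Carrier) →
    antidiagonal n (λ m k → antidiagonal m (λ i j → f i j k)) ≈ antidiagonal n (λ i m → antidiagonal m (f i))
  antidiagonal-assoc zero    f = ≈-refl
  antidiagonal-assoc (suc n) f = begin
    f 0 0 (suc n) + antidiagonal n (λ m k → f 0 (suc m) k + antidiagonal m (λ i j → f (suc i) j k))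
      ≈⟨ +-congˡ (antidiagonal-+ n _ _) ⟩
    f 0 0 (suc n) + (antidiagonal n (λ m k → f 0 (suc m) k) + antidiagonal n (λ m k → antidiagonal m (λ i j → f (suc i) j k)))
      ≈⟨ +-assoc _ _ _ ⟨
    antidiagonal (suc n) (f 0) + antidiagonal n (λ m k → antidiagonal m (λ i j → f (suc i) j k))
      ≈⟨ +-congˡ (antidiagonal-assoc n (f ∘ suc)) ⟩
    antidiagonal (suc n) (f 0) + antidiagonal n (λ i m → antidiagonal m (f (suc i)))
      ∎

  ∑-antidiagonal : ∀ n (f : ℕ → ℕ → Carrier) → ∑ (upTo (suc n)) (λ i → f i (n ∸ i)) ≈ antidiagonal n f
  ∑-antidiagonal zero    f = +-identityʳ _
  ∑-antidiagonal (suc n) f =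
    ≈-trans (∑-upTo-suc (suc n) (λ i → f i (suc n ∸ i))) (+-congˡ (∑-antidiagonal n (λ i j → f (suc i) j)))

private
  module ∑ℕ = ListSum ℕ.+-*-commutativeSemiring

-- Counting in lists, and enumeration of words

tabulate-injective : ∀ {n} {f g : Fin n → A} → tabulate f ≡ tabulate g → ∀ i → f i ≡ g i
tabulate-injective eq zero    = List.∷-injectiveˡ eq
tabulate-injective eq (suc i) = tabulate-injective (List.∷-injectiveʳ eq) i

length-filter≡∑ : {P : Pred A p} (P? : Decidable P) (xs : List A) → length (filter P? xs) ≡ ∑ℕ.∑ xs (∑ℕ.𝟙 ∘ P?)
length-filter≡∑ P? []       = refl
length-filter≡∑ P? (x ∷ xs) with does (P? x)
... | true  = cong suc (length-filter≡∑ P? xs)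
... | false = length-filter≡∑ P? xs

length-singleton : {xs : List A} {x : A} → Unique xs → x ∈ xs → (∀ {y} → y ∈ xs → y ≡ x) → length xs ≡ 1
length-singleton {xs = _ ∷ []}    _                _ _  = refl
length-singleton {xs = _ ∷ _ ∷ _} ((y≢z ∷ _) ∷ _) _ eq =
  contradiction (≡.trans (eq (here refl)) (≡.sym (eq (there (here refl))))) y≢z

words-unique : ∀ n {xs : List A} → Unique xs → Unique (words xs n)
words-unique zero    _   = [] ∷ []
words-unique (suc n) xs! = Unique.cartesianProductWith⁺ Vec._∷_ Vec.∷-injective xs! (words-unique n xs!)

∈-words-allFin : ∀ {m n} (w : Vec (Fin m) n) → w ∈ words (allFin m) n
∈-words-allFin []      = here refl
∈-words-allFin (i ∷ w) = ∈-cartesianProductWith⁺ Vec._∷_ (∈-allFin i) (∈-words-allFin w)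

-- Contents of words

occurrences : ∀ {m n} → Vec (Fin m) n → Fin m → ℕ
occurrences w i = Vec.count (i Fin.≟_) w

occurrences-∷ : ∀ {m n} i x (w : Vec (Fin m) n) → occurrences (x ∷ w) i ≡ ∑ℕ.𝟙 (i Fin.≟ x) ℕ.+ occurrences w i
occurrences-∷ i x w with does (i Fin.≟ x)
... | true  = refl
... | false = refl

∑-occurrences : ∀ {m n} (w : Vec (Fin m) n) → ∑ℕ.∑ (allFin m) (occurrences w) ≡ n
∑-occurrences {m} []              = ∑ℕ.∑-0 (allFin m)
∑-occurrences {m} {suc n} (x ∷ w) = begin
  ∑ (allFin m) (occurrences (x ∷ w))                               ≡⟨ ∑-cong (allFin m) (λ i → occurrences-∷ i x w) ⟩
  ∑ (allFin m) (λ i → 𝟙 (i Fin.≟ x) ℕ.+ occurrences w i)           ≡⟨ ∑-+ (allFin m) _ _ ⟩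
  ∑ (allFin m) (λ i → 𝟙 (i Fin.≟ x)) ℕ.+ ∑ (allFin m) (occurrences w)
    ≡⟨ cong₂ ℕ._+_ (∑-cong (allFin m) (λ i → ≡.trans (𝟙-⇔ (i Fin.≟ x) (x Fin.≟ i) ≡.sym ≡.sym) (≡.sym (ℕ.*-identityʳ _)))) (∑-occurrences w) ⟩
  ∑ (allFin m) (λ i → 𝟙 (x Fin.≟ i) ℕ.* 1) ℕ.+ n                   ≡⟨ cong (ℕ._+ n) (∑-𝟙≟ x (λ _ → 1)) ⟩
  suc n                                                            ∎
  where
  open ∑ℕ
  open ≡.≡-Reasoning

occurrences-tabulate : ∀ {m n} (f : Fin n → Fin m) i →
  occurrences (Vec.tabulate f) i ≡ ∑ℕ.∑ (allFin n) (λ v → ∑ℕ.𝟙 (i Fin.≟ f v))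
occurrences-tabulate {n = zero}  f i = refl
occurrences-tabulate {n = suc n} f i = ≡.trans (occurrences-∷ i (f zero) (Vec.tabulate (f ∘ suc)))
  (≡.trans (cong (∑ℕ.𝟙 (i Fin.≟ f zero) ℕ.+_) (occurrences-tabulate (f ∘ suc) i)) (≡.sym (∑ℕ.∑-allFin-suc n (λ v → ∑ℕ.𝟙 (i Fin.≟ f v)))))

Increasing : ∀ {m n} → Vec (Fin m) n → Set
Increasing = Linked Fin._≤_

increasing-zero∷ : ∀ {m n} {w : Vec (Fin (suc m)) n} → Increasing w → Increasing (zero ∷ w)
increasing-zero∷ {w = []}    _  = [-]
increasing-zero∷ {w = _ ∷ _} w↗ = z≤n ∷ w↗

increasing-zeros : ∀ {m n} k {w : Vec (Fin (suc m)) n} → Increasing w → Increasing (Vec.replicate k zero Vec.++ w)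
increasing-zeros zero    w↗ = w↗
increasing-zeros (suc k) w↗ = increasing-zero∷ (increasing-zeros k w↗)

increasing-map-suc : ∀ {m n} {w : Vec (Fin m) n} → Increasing w → Increasing (Vec.map Fin.suc w)
increasing-map-suc []                     = []
increasing-map-suc [-]                    = [-]
increasing-map-suc {w = _ ∷ _ ∷ _} (r ∷ w↗) = s≤s r ∷ increasing-map-suc w↗

-- The existence half of the fact that each content belongs to exactly one weakly increasing word;
-- `increasing-unique` is the other half. Together they make every degree-n coefficient of `h_n`
-- equal to 1.
sortedWord : (e : List ℕ) → Vec (Fin (length e)) (sum e)
sortedWord []      = []
sortedWord (k ∷ e) = Vec.replicate k zero Vec.++ Vec.map suc (sortedWord e)

sortedWord-increasing : ∀ e → Increasing (sortedWord e)
sortedWord-increasing []      = []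
sortedWord-increasing (k ∷ e) = increasing-zeros k (increasing-map-suc (sortedWord-increasing e))

occurrences-zeros-zero : ∀ {m n} k (w : Vec (Fin m) n) → occurrences (Vec.replicate k zero Vec.++ Vec.map suc w) zero ≡ k
occurrences-zeros-zero (suc k) w       = cong suc (occurrences-zeros-zero k w)
occurrences-zeros-zero zero    []      = refl
occurrences-zeros-zero zero    (_ ∷ w) = occurrences-zeros-zero zero w

occurrences-zeros-suc : ∀ {m n} k (w : Vec (Fin m) n) i →
  occurrences (Vec.replicate k zero Vec.++ Vec.map suc w) (suc i) ≡ occurrences w i
occurrences-zeros-suc (suc k) w       i = occurrences-zeros-suc k w i
occurrences-zeros-suc zero    []      i = refl
occurrences-zeros-suc zero    (x ∷ w) i = begin
  occurrences (suc x ∷ Vec.map suc w) (suc i)                                 ≡⟨ occurrences-∷ (suc i) (suc x) (Vec.map suc w) ⟩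
  ∑ℕ.𝟙 (suc i Fin.≟ suc x) ℕ.+ occurrences (Vec.map suc w) (suc i)
    ≡⟨ cong₂ ℕ._+_ (∑ℕ.𝟙-⇔ (suc i Fin.≟ suc x) (i Fin.≟ x) Fin.suc-injective (cong suc)) (occurrences-zeros-suc zero w i) ⟩
  ∑ℕ.𝟙 (i Fin.≟ x) ℕ.+ occurrences w i                                        ≡⟨ occurrences-∷ i x w ⟨
  occurrences (x ∷ w) i                                                       ∎
  where open ≡.≡-Reasoning

occurrences-sortedWord : ∀ e → tabulate (occurrences (sortedWord e)) ≡ e
occurrences-sortedWord []      = refl
occurrences-sortedWord (k ∷ e) = cong₂ _∷_ (occurrences-zeros-zero k (sortedWord e))
  (≡.trans (List.tabulate-cong (occurrences-zeros-suc k (sortedWord e))) (occurrences-sortedWord e))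

occurrences-below : ∀ {m n} {i x : Fin m} {w : Vec (Fin m) n} → i Fin.< x → Increasing (x ∷ w) → occurrences (x ∷ w) i ≡ 0
occurrences-below {i = i} {x} {w} i<x x∷w↗ = ≡.trans (occurrences-∷ i x w)
  (cong₂ ℕ._+_ (∑ℕ.𝟙-no (i Fin.≟ x) (λ { refl → ℕ.<-irrefl refl i<x })) (rest w x∷w↗))
  where
  rest : ∀ {n} (w : Vec _ n) → Increasing (x ∷ w) → occurrences w i ≡ 0
  rest []      _          = refl
  rest (_ ∷ _) (x≤y ∷ w↗) = occurrences-below (ℕ.<-≤-trans i<x x≤y) w↗

occurrences-head : ∀ {m n} (x : Fin m) (w : Vec (Fin m) n) → occurrences (x ∷ w) x ≢ 0
occurrences-head x w eq with () ←
  ≡.trans (≡.sym eq) (≡.trans (occurrences-∷ x x w) (cong (ℕ._+ occurrences w x) (∑ℕ.𝟙-yes (x Fin.≟ x) refl)))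

-- Every letter of a weakly increasing word is at least its head, so a strictly smaller head of the
-- other word could not occur in it. Hence the heads agree, and cancelling them leaves tails of
-- equal content.
increasing-unique : ∀ {m n} {v w : Vec (Fin m) n} → Increasing v → Increasing w →
  (∀ i → occurrences v i ≡ occurrences w i) → v ≡ w
increasing-unique {v = []}    {[]}    _  _  _  = refl
increasing-unique {v = x ∷ v} {y ∷ w} v↗ w↗ eq with Fin.<-cmp x y
... | tri< x<y _ _ = contradiction (≡.trans (eq x) (occurrences-below x<y w↗)) (occurrences-head x v)
... | tri> _ _ y<x = contradiction (≡.trans (≡.sym (eq y)) (occurrences-below y<x v↗)) (occurrences-head y w)
... | tri≈ _ refl _ = cong (x ∷_) (increasing-unique (Linked.tail v↗) (Linked.tail w↗) λ i →
  ℕ.+-cancelˡ-≡ (∑ℕ.𝟙 (i Fin.≟ x)) _ _ (≡.trans (≡.sym (occurrences-∷ i x v)) (≡.trans (eq i) (occurrences-∷ i x w))))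

-- Compositions

-- |β| minus the last part of β, that is, the largest element of D(β) if ℓ(β) ≥ 2.
initSum : Composition → ℕ
initSum []          = 0
initSum (_ ∷ [])    = 0
initSum (a ∷ b ∷ β) = value a ℕ.+ initSum (b ∷ β)

1≤value : (a : ℕ⁺) → 1 ≤ value a
1≤value (pos (suc _)) = s≤s z≤n

descents-bounds : ∀ β {d} → d ∈ descents β → 1 ≤ d × d ≤ initSum β
descents-bounds (a ∷ b ∷ β) (here refl) = 1≤value a , ℕ.m≤m+n _ _
descents-bounds (a ∷ b ∷ β) (there d∈) =
  let d′ , d′∈ , eq = ∈-map⁻ (value a ℕ.+_) d∈
      _ , d′≤       = descents-bounds (b ∷ β) d′∈
  in ≡.subst (λ d → 1 ≤ d × d ≤ initSum (a ∷ b ∷ β)) (≡.sym eq)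
       (ℕ.≤-trans (1≤value a) (ℕ.m≤m+n _ _) , ℕ.+-monoʳ-≤ (value a) d′≤)

initSum∈descents : ∀ a b β → initSum (a ∷ b ∷ β) ∈ descents (a ∷ b ∷ β)
initSum∈descents a b []      = here (ℕ.+-identityʳ _)
initSum∈descents a b (c ∷ β) = there (∈-map⁺ (value a ℕ.+_) (initSum∈descents b c β))

-- Every part except the last contributes at least 1. The bound makes the truncated subtraction in
-- the sign of a ribbon coefficient exact for hooks.
length≤1+initSum : ∀ β → length β ≤ suc (initSum β)
length≤1+initSum []          = z≤n
length≤1+initSum (a ∷ [])    = s≤s z≤n
length≤1+initSum (a ∷ b ∷ β) = s≤s (ℕ.≤-trans (length≤1+initSum (b ∷ β)) (ℕ.+-monoˡ-≤ _ (1≤value a)))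

descents-hook : ∀ i x → descents (replicate i (pos 1) ++ x ∷ []) ≡ applyUpTo suc i
descents-hook zero          x = refl
descents-hook (suc zero)    x = refl
descents-hook (suc (suc i)) x = cong (1 ∷_) (≡.trans (cong (map suc) (descents-hook (suc i) x)) (List.map-applyUpTo suc suc (suc i)))

∣hook∣ : ∀ i x → ∣ replicate i (pos 1) ++ x ∷ [] ∣ᶜ ≡ i ℕ.+ value x
∣hook∣ zero    x = ℕ.+-identityʳ _
∣hook∣ (suc i) x = cong suc (∣hook∣ i x)

-- The descent set of a hook is the full interval from 1 to i, so containment in it is decided by
-- the largest descent alone, which is `initSum β`.
≥ᶜ-hook⁻ : ∀ β i {x} → β ≥ᶜ (replicate i (pos 1) ++ x ∷ []) → initSum β ≤ i
≥ᶜ-hook⁻ []          i _ = z≤n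
≥ᶜ-hook⁻ (_ ∷ [])    i _ = z≤n
≥ᶜ-hook⁻ (a ∷ b ∷ β) i {x} (_ , D⊆)
  with j , j<i , eq ← ∈-applyUpTo⁻ suc (≡.subst (_ ∈_) (descents-hook i x) (D⊆ (initSum∈descents a b β)))
  = ≡.subst (_≤ i) (≡.sym eq) j<i

≥ᶜ-hook⁺ : ∀ β i {x} → ∣ β ∣ᶜ ≡ i ℕ.+ value x → initSum β ≤ i → β ≥ᶜ (replicate i (pos 1) ++ x ∷ [])
≥ᶜ-hook⁺ β i {x} ∣β∣≡ init≤i = ≡.trans ∣β∣≡ (≡.sym (∣hook∣ i x)) ,
  λ d∈ → ≡.subst (_ ∈_) (≡.sym (descents-hook i x)) (below (descents-bounds β d∈))
  where
  below : ∀ {d} → 1 ≤ d × d ≤ initSum β → d ∈ applyUpTo suc i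
  below (s≤s z≤n , d≤) = ∈-applyUpTo⁺ suc (ℕ.≤-trans d≤ init≤i)

-- Matching on `cons` exposes the first part of a composition known only through membership;
-- `ΨCoefficient` reduces, and `hooks-coefficient` applies, once it is visible.
data NonEmpty {A : Set a} : List A → Set a where
  cons : ∀ x xs → NonEmpty (x ∷ xs)

∈-compositionsFrom : ∀ a .{{_ : NonZero a}} n {β} → β ∈ compositionsFrom a n → NonEmpty β × ∣ β ∣ᶜ ≡ a ℕ.+ n
∈-compositionsFrom a zero    (here refl) = cons _ [] , refl
∈-compositionsFrom a (suc n) β∈ with ∈-++⁻ (map (pos a ∷_) (compositionsFrom 1 n)) β∈
... | inj₂ β∈′ with ne , eq ← ∈-compositionsFrom (suc a) n β∈′ = ne , ≡.trans eq (≡.sym (ℕ.+-suc a n))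
... | inj₁ β∈′ with γ , γ∈ , refl ← ∈-map⁻ (pos a ∷_) β∈′ =
  cons _ γ , cong (a ℕ.+_) (proj₂ (∈-compositionsFrom 1 n γ∈))

-- Colourings that are constant on components

unique-lookup-injective : {xs : List A} → Unique xs → ∀ {i j} → lookup xs i ≡ lookup xs j → i ≡ j
unique-lookup-injective (_ ∷ _)    {zero}  {zero}  _  = refl
unique-lookup-injective (x∉ ∷ _)   {zero}  {suc j} eq = contradiction eq (All.lookup x∉ (∈-lookup j))
unique-lookup-injective (x∉ ∷ _)   {suc i} {zero}  eq = contradiction (≡.sym eq) (All.lookup x∉ (∈-lookup i))
unique-lookup-injective (_ ∷ xs!)  {suc i} {suc j} eq = cong suc (unique-lookup-injective xs! eq)

lookup-extensional : ∀ {n} {v w : Vec A n} → (∀ i → Vec.lookup v i ≡ Vec.lookup w i) → v ≡ w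
lookup-extensional {v = v} {w} eq =
  ≡.trans (≡.sym (Vec.tabulate∘lookup v)) (≡.trans (Vec.tabulate-cong eq) (Vec.tabulate∘lookup w))

Monochromatic : ∀ {m n} → Vec (Fin m) n → Fin n × Fin n → Set
Monochromatic w (u , v) = Vec.lookup w u ≡ Vec.lookup w v

monochromatic? : ∀ {m n} (w : Vec (Fin m) n) → Decidable (Monochromatic w)
monochromatic? w (u , v) = Vec.lookup w u Fin.≟ Vec.lookup w v

monochromatic-connected : ∀ {m n} (w : Vec (Fin m) n) {S} → All (Monochromatic w) S →
  ∀ {u v} → Connected S u v → Vec.lookup w u ≡ Vec.lookup w v
monochromatic-connected w mono = Eq.gfold ≡.isEquivalence (Vec.lookup w) (All.lookup mono)

-- The exponents of the product of x_{d_j}^{size_j} over all positions j: the term of a product of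
-- power sums obtained by picking the variable d_j in the j-th factor, or the colour multiplicities
-- when a block of that size receives colour d_j.
content : ∀ {m} (size : A → ℕ) (xs : List A) → Vec (Fin m) (length xs) → Fin m → ℕ
content size []       []      i = 0
content size (x ∷ xs) (j ∷ d) i = ∑ℕ.𝟙 (i Fin.≟ j) ℕ.* size x ℕ.+ content size xs d i

content≡∑ : ∀ {m} (size : A → ℕ) (xs : List A) (d : Vec (Fin m) (length xs)) i →
  content size xs d i ≡ ∑ℕ.∑ (allFin (length xs)) (λ j → ∑ℕ.𝟙 (i Fin.≟ Vec.lookup d j) ℕ.* size (lookup xs j))
content≡∑ size []       []      i = refl
content≡∑ size (x ∷ xs) (j ∷ d) i = ≡.trans (cong (∑ℕ.𝟙 (i Fin.≟ j) ℕ.* size x ℕ.+_) (content≡∑ size xs d i))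
  (≡.sym (∑ℕ.∑-allFin-suc (length xs) (λ l → ∑ℕ.𝟙 (i Fin.≟ Vec.lookup (j ∷ d) l) ℕ.* size (lookup (x ∷ xs) l))))

-- Colourings of the vertices that are constant on components are matched with colourings of the
-- positions in `Cs`. `index` sends a vertex to the position of its component and `rep` picks a
-- vertex at each position; `rep (index v)` is connected to v, while `index (rep j)` is j itself.
module ComponentColourings {n} (S : List (Fin n × Fin n)) {Cs : List (List (Fin n))} (Cs↭ : Cs ↭ components S) where

  private
    _≟ᶜ_ = List.≡-dec (Fin._≟_ {n})

  Cs-unique : Unique Cs
  Cs-unique = ↭ₛ.Unique-resp-↭ (≡.setoid _) (↭⇒↭ₛ (↭-sym Cs↭)) (UniqueDec.deduplicate-! _≟ᶜ_ _)

  component∈ : ∀ v → component S v ∈ Cs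
  component∈ v = ∈-resp-↭ (↭-sym Cs↭) (∈-deduplicate⁺ _≟ᶜ_ (∈-map⁺ (component S) (∈-allFin v)))

  index : Fin n → Fin (length Cs)
  index v = Any.index (component∈ v)

  lookup-index≡component : ∀ v → lookup Cs (index v) ≡ component S v
  lookup-index≡component v = ≡.sym (lookup-index (component∈ v))

  representative : ∀ j → ∃[ v ] lookup Cs j ≡ component S v
  representative j with v , _ , eq ← ∈-map⁻ (component S) (∈-deduplicate⁻ _≟ᶜ_ _ (∈-resp-↭ Cs↭ (∈-lookup j))) = v , eq

  rep : Fin (length Cs) → Fin n
  rep j = proj₁ (representative j)

  index-rep : ∀ j → index (rep j) ≡ j
  index-rep j = unique-lookup-injective Cs-unique
    (≡.trans (lookup-index≡component (rep j)) (≡.sym (proj₂ (representative j))))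

  -- Connected vertices filter `allFin n` by equivalent predicates, so their components are the same
  -- list; since `Cs` has no duplicates, that list has one position.
  connected⇒index≡ : ∀ {u v} → Connected S u v → index u ≡ index v
  connected⇒index≡ {u} {v} u~v = unique-lookup-injective Cs-unique (≡.trans (lookup-index≡component u)
    (≡.trans (List.filter-≐ (connected? S u) (connected? S v)
        ((λ u~x → Eq.symmetric _ u~v ◅◅ u~x) , (λ v~x → u~v ◅◅ v~x)) (allFin n))
      (≡.sym (lookup-index≡component v))))

  index≡⇒connected : ∀ {u v} → index u ≡ index v → Connected S u v
  index≡⇒connected {u} {v} eq = proj₂ (∈-filter⁻ (connected? S u) {xs = allFin n} (≡.subst (v ∈_)
    (≡.trans (≡.sym (lookup-index≡component v)) (≡.trans (cong (lookup Cs) (≡.sym eq)) (lookup-index≡component u)))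
    (∈-filter⁺ (connected? S v) (∈-allFin v) ε)))

  length-component : ∀ j → length (lookup Cs j) ≡ ∑ℕ.∑ (allFin n) (λ v → ∑ℕ.𝟙 (index v Fin.≟ j))
  length-component j = ≡.trans (cong length (proj₂ (representative j)))
    (≡.trans (length-filter≡∑ (connected? S (rep j)) (allFin n))
      (∑ℕ.∑-cong (allFin n) (λ v → ∑ℕ.𝟙-⇔ (connected? S (rep j) v) (index v Fin.≟ j)
        (λ r~v → ≡.trans (≡.sym (connected⇒index≡ r~v)) (index-rep j))
        (λ eq → index≡⇒connected (≡.trans (index-rep j) (≡.sym eq))))))

  module _ {m : ℕ} where

    colouring : Vec (Fin m) (length Cs) → Vec (Fin m) n
    colouring d = Vec.tabulate (Vec.lookup d ∘ index)

    lookup-colouring : ∀ d v → Vec.lookup (colouring d) v ≡ Vec.lookup d (index v)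
    lookup-colouring d = Vec.lookup∘tabulate (Vec.lookup d ∘ index)

    colouring-injective : ∀ {d d′} → colouring d ≡ colouring d′ → d ≡ d′
    colouring-injective {d} {d′} eq = lookup-extensional λ j → begin
      Vec.lookup d j                       ≡⟨ cong (Vec.lookup d) (index-rep j) ⟨
      Vec.lookup d (index (rep j))         ≡⟨ lookup-colouring d (rep j) ⟨
      Vec.lookup (colouring d) (rep j)     ≡⟨ cong (λ w → Vec.lookup w (rep j)) eq ⟩
      Vec.lookup (colouring d′) (rep j)    ≡⟨ lookup-colouring d′ (rep j) ⟩
      Vec.lookup d′ (index (rep j))        ≡⟨ cong (Vec.lookup d′) (index-rep j) ⟩
      Vec.lookup d′ j                      ∎
      where open ≡.≡-Reasoning

    colouring-monochromatic : ∀ d → All (Monochromatic (colouring d)) S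
    colouring-monochromatic d = All.tabulate λ {(u , v)} uv∈ →
      ≡.trans (lookup-colouring d u) (≡.trans (cong (Vec.lookup d) (connected⇒index≡ (Eq.return uv∈))) (≡.sym (lookup-colouring d v)))

    -- Colours are read off at the representatives. This loses nothing, because a vertex is
    -- connected to the representative of its component and `w` is constant along connections.
    colouring-surjective : ∀ w → All (Monochromatic w) S → w ≡ colouring (Vec.tabulate (Vec.lookup w ∘ rep))
    colouring-surjective w mono = lookup-extensional λ v → begin
      Vec.lookup w v                                                     ≡⟨ monochromatic-connected w mono (index≡⇒connected (≡.sym (index-rep (index v)))) ⟩
      Vec.lookup w (rep (index v))                                       ≡⟨ Vec.lookup∘tabulate (Vec.lookup w ∘ rep) (index v) ⟨
      Vec.lookup (Vec.tabulate (Vec.lookup w ∘ rep)) (index v)           ≡⟨ lookup-colouring (Vec.tabulate (Vec.lookup w ∘ rep)) v ⟨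
      Vec.lookup (colouring (Vec.tabulate (Vec.lookup w ∘ rep))) v       ∎
      where open ≡.≡-Reasoning

    -- Both lists are free of duplicates and have the same members, hence agree up to order. This is
    -- what turns a sum over colourings of components into a sum over vertex colourings.
    colourings-↭ : map colouring (words (allFin m) (length Cs)) ↭
      filter (λ w → All.all? (monochromatic? w) S) (words (allFin m) n)
    colourings-↭ = ∼bag⇒↭ (unique∧set⇒bag
      (Unique.map⁺ colouring-injective (words-unique (length Cs) (Unique.allFin⁺ m)))
      (Unique.filter⁺ mono? (words-unique n (Unique.allFin⁺ m)))
      (mk⇔ to from))
      where
      mono? = λ w → All.all? (monochromatic? w) S
      to : ∀ {w} → w ∈ map colouring (words (allFin m) (length Cs)) → w ∈ filter mono? (words (allFin m) n)
      to w∈ with d , _ , refl ← ∈-map⁻ colouring w∈ = ∈-filter⁺ mono? (∈-words-allFin _) (colouring-monochromatic d)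
      from : ∀ {w} → w ∈ filter mono? (words (allFin m) n) → w ∈ map colouring (words (allFin m) (length Cs))
      from {w} w∈ with _ , mono ← ∈-filter⁻ mono? {xs = words (allFin m) n} w∈ =
        ≡.subst (_∈ map colouring (words (allFin m) (length Cs))) (≡.sym (colouring-surjective w mono))
          (∈-map⁺ colouring (∈-words-allFin (Vec.tabulate (Vec.lookup w ∘ rep))))

    -- Double counting of the pairs (v, j) with `index v` equal to j and d_j equal to i: summed over
    -- j first they count vertices of colour i, summed over v first they add the sizes of the
    -- components coloured i.
    occurrences-colouring : ∀ d i → occurrences (colouring d) i ≡ content length Cs d i
    occurrences-colouring d i = begin
      occurrences (colouring d) i
        ≡⟨ occurrences-tabulate (Vec.lookup d ∘ index) i ⟩
      ∑ (allFin n) (λ v → 𝟙 (i Fin.≟ Vec.lookup d (index v)))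
        ≡⟨ ∑-cong (allFin n) (λ v → ∑-𝟙≟ (index v) (λ j → 𝟙 (i Fin.≟ Vec.lookup d j))) ⟨
      ∑ (allFin n) (λ v → ∑ (allFin (length Cs)) (λ j → 𝟙 (index v Fin.≟ j) ℕ.* 𝟙 (i Fin.≟ Vec.lookup d j)))
        ≡⟨ ∑-swap (allFin n) (allFin (length Cs)) _ ⟩
      ∑ (allFin (length Cs)) (λ j → ∑ (allFin n) (λ v → 𝟙 (index v Fin.≟ j) ℕ.* 𝟙 (i Fin.≟ Vec.lookup d j)))
        ≡⟨ ∑-cong (allFin (length Cs)) (λ j → ≡.trans (≡.sym (∑-* _ (allFin n) _))
             (≡.trans (cong (ℕ._* 𝟙 (i Fin.≟ Vec.lookup d j)) (≡.sym (length-component j))) (ℕ.*-comm (length (lookup Cs j)) _))) ⟩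
      ∑ (allFin (length Cs)) (λ j → 𝟙 (i Fin.≟ Vec.lookup d j) ℕ.* length (lookup Cs j))
        ≡⟨ content≡∑ length Cs d i ⟨
      content length Cs d i
        ∎
      where
      open ∑ℕ
      open ≡.≡-Reasoning

module _ {c ℓ} (𝕜 : Field c ℓ) where
  open Field 𝕜 renaming (refl to ≈-refl; sym to ≈-sym; trans to ≈-trans; zero to *-zero)
  open OverField 𝕜
  open ListSum commutativeSemiring
  open SemiringMult semiring using (×-homo-+; ×-congˡ) renaming (_×_ to _·_)
  open SemiringExp semiring using (^-homo-*)
  open RingProperties ring using (-1*x≈-x; -‿involutive)
  open CommutativeSemigroupProperties *-commutativeSemigroup using () renaming (x∙yz≈y∙xz to x*yz≈y*xz; interchange to *-interchange)
  open import Relation.Binary.Reasoning.Setoid setoid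

  -- Products of power series

  ∑ᶠ : Monomial → (Monomial → Monomial → Carrier) → Carrier
  ∑ᶠ e f = ∑ (factorizations e) (uncurry f)

  ∑ᶠ-cong : ∀ e {f g : Monomial → Monomial → Carrier} → (∀ x y → f x y ≈ g x y) → ∑ᶠ e f ≈ ∑ᶠ e g
  ∑ᶠ-cong e eq = ∑-cong (factorizations e) (uncurry eq)

  -- Separates the first variable from the others. The laws of the series product then follow by
  -- induction on the exponent list, with the `antidiagonal` identities handling one variable at a
  -- time.
  ∑ᶠ-∷ : ∀ n e (f : Monomial → Monomial → Carrier) →
    ∑ᶠ (n ∷ e) f ≈ antidiagonal n (λ i j → ∑ᶠ e (λ x y → f (i ∷ x) (j ∷ y)))
  ∑ᶠ-∷ n e f = ≈-trans
    (∑-cartesianProductWith (λ i (x , y) → i ∷ x , (n ∸ i) ∷ y) (upTo (suc n)) (factorizations e) (uncurry f))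
    (∑-antidiagonal n (λ i j → ∑ᶠ e (λ x y → f (i ∷ x) (j ∷ y))))

  ∑ᶠ-flip : ∀ e (f : Monomial → Monomial → Carrier) → ∑ᶠ e f ≈ ∑ᶠ e (flip f)
  ∑ᶠ-flip []      f = ≈-refl
  ∑ᶠ-flip (n ∷ e) f = begin
    ∑ᶠ (n ∷ e) f                                                ≈⟨ ∑ᶠ-∷ n e f ⟩
    antidiagonal n (λ i j → ∑ᶠ e (λ x y → f (i ∷ x) (j ∷ y)))   ≈⟨ antidiagonal-cong n (λ i j → ∑ᶠ-flip e _) ⟩
    antidiagonal n (λ i j → ∑ᶠ e (λ y x → f (i ∷ x) (j ∷ y)))   ≈⟨ antidiagonal-flip n _ ⟩
    antidiagonal n (λ j i → ∑ᶠ e (λ y x → f (i ∷ x) (j ∷ y)))   ≈⟨ ∑ᶠ-∷ n e (flip f) ⟨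
    ∑ᶠ (n ∷ e) (flip f)                                         ∎

  ∑ᶠ-assoc : ∀ e (f : Monomial → Monomial → Monomial → Carrier) →
    ∑ᶠ e (λ w z → ∑ᶠ w (λ x y → f x y z)) ≈ ∑ᶠ e (λ x w → ∑ᶠ w (f x))
  ∑ᶠ-assoc []      f = ≈-refl
  ∑ᶠ-assoc (n ∷ e) f = begin
    ∑ᶠ (n ∷ e) (λ w z → ∑ᶠ w (λ x y → f x y z))
      ≈⟨ ∑ᶠ-∷ n e _ ⟩
    antidiagonal n (λ m k → ∑ᶠ e (λ w z → ∑ᶠ (m ∷ w) (λ x y → f x y (k ∷ z))))
      ≈⟨ antidiagonal-cong n (λ m k → ≈-trans (∑ᶠ-cong e (λ w z → ∑ᶠ-∷ m w _)) (≈-sym (antidiagonal-∑ m (factorizations e) _))) ⟩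
    antidiagonal n (λ m k → antidiagonal m (λ i j → ∑ᶠ e (λ w z → ∑ᶠ w (λ x y → f (i ∷ x) (j ∷ y) (k ∷ z)))))
      ≈⟨ antidiagonal-cong n (λ m k → antidiagonal-cong m (λ i j → ∑ᶠ-assoc e _)) ⟩
    antidiagonal n (λ m k → antidiagonal m (λ i j → ∑ᶠ e (λ x w → ∑ᶠ w (λ y z → f (i ∷ x) (j ∷ y) (k ∷ z)))))
      ≈⟨ antidiagonal-assoc n (λ i j k → ∑ᶠ e (λ x w → ∑ᶠ w (λ y z → f (i ∷ x) (j ∷ y) (k ∷ z)))) ⟩
    antidiagonal n (λ i m → antidiagonal m (λ j k → ∑ᶠ e (λ x w → ∑ᶠ w (λ y z → f (i ∷ x) (j ∷ y) (k ∷ z)))))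
      ≈⟨ antidiagonal-cong n (λ i m → ≈-trans (antidiagonal-∑ m (factorizations e) _) (∑ᶠ-cong e (λ x w → ≈-sym (∑ᶠ-∷ m w _)))) ⟩
    antidiagonal n (λ i m → ∑ᶠ e (λ x w → ∑ᶠ (m ∷ w) (f (i ∷ x))))
      ≈⟨ ∑ᶠ-∷ n e _ ⟨
    ∑ᶠ (n ∷ e) (λ x w → ∑ᶠ w (f x))
      ∎

  *ˢ-cong : ∀ {f f′ g g′ : Series} → f ≈ˢ f′ → g ≈ˢ g′ → f *ˢ g ≈ˢ f′ *ˢ g′
  *ˢ-cong f≈ g≈ e = ∑ᶠ-cong e (λ x y → *-cong (f≈ x) (g≈ y))

  *ˢ-comm : ∀ f g → f *ˢ g ≈ˢ g *ˢ f
  *ˢ-comm f g e = ≈-trans (∑ᶠ-flip e _) (∑ᶠ-cong e (λ x y → *-comm _ _))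

  *ˢ-assoc : ∀ f g k → (f *ˢ g) *ˢ k ≈ˢ f *ˢ (g *ˢ k)
  *ˢ-assoc f g k e = begin
    ∑ᶠ e (λ w z → ∑ᶠ w (λ x y → f x * g y) * k z)     ≈⟨ ∑ᶠ-cong e (λ w z → ∑-* (k z) (factorizations w) _) ⟩
    ∑ᶠ e (λ w z → ∑ᶠ w (λ x y → (f x * g y) * k z))   ≈⟨ ∑ᶠ-assoc e (λ x y z → (f x * g y) * k z) ⟩
    ∑ᶠ e (λ x w → ∑ᶠ w (λ y z → (f x * g y) * k z))   ≈⟨ ∑ᶠ-cong e (λ x w → ∑ᶠ-cong w (λ y z → *-assoc _ _ _)) ⟩
    ∑ᶠ e (λ x w → ∑ᶠ w (λ y z → f x * (g y * k z)))   ≈⟨ ∑ᶠ-cong e (λ x w → *-∑ (f x) (factorizations w) _) ⟨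
    ∑ᶠ e (λ x w → f x * ∑ᶠ w (λ y z → g y * k z))     ∎

  *ˢ-swap : ∀ f g k → f *ˢ (g *ˢ k) ≈ˢ g *ˢ (f *ˢ k)
  *ˢ-swap f g k e = begin
    (f *ˢ (g *ˢ k)) e  ≈⟨ *ˢ-assoc f g k e ⟨
    (f *ˢ g *ˢ k) e    ≈⟨ *ˢ-cong (*ˢ-comm f g) (λ _ → ≈-refl) e ⟩
    (g *ˢ f *ˢ k) e    ≈⟨ *ˢ-assoc g f k e ⟩
    (g *ˢ (f *ˢ k)) e  ∎

  -- Only the term with i = k survives. If k > n there is no such term, and the factor for
  -- `k ℕ.≤? n` suppresses the meaningless value at `n ∸ k`.
  antidiagonal-𝟙 : ∀ n k (f : ℕ → Carrier) →
    antidiagonal n (λ i j → 𝟙 (i ℕ.≟ k) * f j) ≈ 𝟙 (k ℕ.≤? n) * f (n ∸ k)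
  antidiagonal-𝟙 zero    zero    f = ≈-refl
  antidiagonal-𝟙 zero    (suc k) f = ≈-trans (zeroˡ _) (≈-sym (zeroˡ _))
  antidiagonal-𝟙 (suc n) zero    f = begin
    1# * f (suc n) + antidiagonal n (λ i j → 0# * f j)  ≈⟨ +-congˡ (≈-trans (antidiagonal-cong n (λ i j → zeroˡ _)) (antidiagonal-0 n)) ⟩
    1# * f (suc n) + 0#                                 ≈⟨ +-identityʳ _ ⟩
    1# * f (suc n)                                      ∎
  antidiagonal-𝟙 (suc n) (suc k) f = begin
    0# * f (suc n) + antidiagonal n (λ i j → 𝟙 (i ℕ.≟ k) * f j)  ≈⟨ +-congʳ (zeroˡ _) ⟩
    0# + antidiagonal n (λ i j → 𝟙 (i ℕ.≟ k) * f j)              ≈⟨ +-identityˡ _ ⟩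
    antidiagonal n (λ i j → 𝟙 (i ℕ.≟ k) * f j)                   ≈⟨ antidiagonal-𝟙 n k f ⟩
    𝟙 (k ℕ.≤? n) * f (n ∸ k)                                     ≈⟨ *-congʳ (𝟙-⇔ (k ℕ.≤? n) (suc k ℕ.≤? suc n) s≤s ℕ.s≤s⁻¹) ⟩
    𝟙 (suc k ℕ.≤? suc n) * f (n ∸ k)                             ∎

  1ˢ-∷ : ∀ i e → 1ˢ (i ∷ e) ≈ 𝟙 (i ℕ.≟ 0) * 1ˢ e
  1ˢ-∷ zero    e = ≈-sym (*-identityˡ _)
  1ˢ-∷ (suc i) e = ≈-sym (zeroˡ _)

  1ˢ-identityˡ : ∀ f → 1ˢ *ˢ f ≈ˢ f
  1ˢ-identityˡ f []      = ≈-trans (+-identityʳ _) (*-identityˡ _)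
  1ˢ-identityˡ f (n ∷ e) = begin
    (1ˢ *ˢ f) (n ∷ e)
      ≈⟨ ∑ᶠ-∷ n e _ ⟩
    antidiagonal n (λ i j → ∑ᶠ e (λ x y → 1ˢ (i ∷ x) * f (j ∷ y)))
      ≈⟨ antidiagonal-cong n (λ i j → ≈-trans (∑ᶠ-cong e (λ x y → ≈-trans (*-congʳ (1ˢ-∷ i x)) (*-assoc _ _ _))) (≈-sym (*-∑ _ (factorizations e) _))) ⟩
    antidiagonal n (λ i j → 𝟙 (i ℕ.≟ 0) * (1ˢ *ˢ (f ∘ (j ∷_))) e)
      ≈⟨ antidiagonal-cong n (λ i j → *-congˡ (1ˢ-identityˡ (f ∘ (j ∷_)) e)) ⟩
    antidiagonal n (λ i j → 𝟙 (i ℕ.≟ 0) * f (j ∷ e))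
      ≈⟨ antidiagonal-𝟙 n 0 (λ j → f (j ∷ e)) ⟩
    1# * f (n ∷ e)
      ≈⟨ *-identityˡ _ ⟩
    f (n ∷ e)
      ∎

  1ˢ-identityʳ : ∀ f → f *ˢ 1ˢ ≈ˢ f
  1ˢ-identityʳ f e = ≈-trans (*ˢ-comm f 1ˢ e) (1ˢ-identityˡ f e)

  -- The algebra morphism NSym → Series

  hˢ-product : Composition → Series
  hˢ-product = foldr (λ n f → hˢ (value n) *ˢ f) 1ˢ

  hˢ-product-↭ : ∀ {α β} → α ↭ β → hˢ-product α ≈ˢ hˢ-product β
  hˢ-product-↭ ↭.refl        e = ≈-refl
  hˢ-product-↭ (prep a r)    e = *ˢ-cong (λ _ → ≈-refl) (hˢ-product-↭ r) e
  hˢ-product-↭ (swap a b r)  e = ≈-trans (*ˢ-swap (hˢ (value a)) (hˢ (value b)) _ e)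
    (*ˢ-cong (λ _ → ≈-refl) (*ˢ-cong (λ _ → ≈-refl) (hˢ-product-↭ r)) e)
  hˢ-product-↭ (↭.trans r s) e = ≈-trans (hˢ-product-↭ r e) (hˢ-product-↭ s e)

  hˢ-product-++ : ∀ α β → hˢ-product (α ++ β) ≈ˢ hˢ-product α *ˢ hˢ-product β
  hˢ-product-++ []      β e = ≈-sym (1ˢ-identityˡ _ e)
  hˢ-product-++ (a ∷ α) β e = ≈-trans (*ˢ-cong (λ _ → ≈-refl) (hˢ-product-++ α β) e) (≈-sym (*ˢ-assoc (hˢ (value a)) _ _ e))

  φ : NSym → Series
  φ x e = ∑ x (λ (k , β) → k * hˢ-product β e)

  ⟦χ⟧≈φ : ∀ x → ⟦ χ x ⟧ ≈ˢ φ x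
  ⟦χ⟧≈φ x e = begin
    ⟦ χ x ⟧ e
      ≈⟨ ∑-concatMap (λ (k , β) → k • h (sort β)) x (λ (k , μ) → k * hˢ-product (parts μ) e) ⟩
    ∑ x (λ (k , β) → k * 1# * hˢ-product (parts (sort β)) e + 0#)
      ≈⟨ ∑-cong x (λ (k , β) → ≈-trans (+-identityʳ _) (*-cong (*-identityʳ k) (hˢ-product-↭ (sort-↭ β) e))) ⟩
    φ x e
      ∎
    where open Sort ≥-decTotalOrder using (sort-↭)

  φ-∑ : (xs : List A) (f : A → NSym) → ∀ e → φ (∑-syntax xs f) e ≈ ∑ xs (λ x → φ (f x) e)
  φ-∑ xs f e = ∑-concatMap f xs _

  φ-• : ∀ k x e → φ (k • x) e ≈ k * φ x e
  φ-• k x e = ≈-trans (∑-map _ x _) (≈-trans (∑-cong x (λ _ → *-assoc _ _ _)) (≈-sym (*-∑ k x _)))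

  φ-H : ∀ β → φ (H β) ≈ˢ hˢ-product β
  φ-H β e = ≈-trans (+-identityʳ _) (*-identityˡ _)

  φ-*ᴺ : ∀ x y → φ (x *ᴺ y) ≈ˢ φ x *ˢ φ y
  φ-*ᴺ x y e = begin
    φ (x *ᴺ y) e
      ≈⟨ ∑-cartesianProductWith (λ (k , α) (l , β) → k * l , α ++ β) x y _ ⟩
    ∑ x (λ (k , α) → ∑ y (λ (l , β) → k * l * hˢ-product (α ++ β) e))
      ≈⟨ ∑-cong x (λ (k , α) → ∑-cong y (λ (l , β) → expand k l α β)) ⟩
    ∑ x (λ s → ∑ y (λ t → ∑ᶠ e (λ u v → term s u * term t v)))
      ≈⟨ ∑-cong x (λ s → ∑-swap y (factorizations e) _) ⟩
    ∑ x (λ s → ∑ᶠ e (λ u v → ∑ y (λ t → term s u * term t v)))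
      ≈⟨ ∑-swap x (factorizations e) _ ⟩
    ∑ᶠ e (λ u v → ∑ x (λ s → ∑ y (λ t → term s u * term t v)))
      ≈⟨ ∑ᶠ-cong e (λ u v → ≈-trans (∑-cong x (λ s → ≈-sym (*-∑ (term s u) y _))) (≈-sym (∑-* (φ y v) x _))) ⟩
    (φ x *ˢ φ y) e
      ∎
    where
    term : Carrier × Composition → Series
    term (k , α) e = k * hˢ-product α e
    expand : ∀ k l α β → k * l * hˢ-product (α ++ β) e ≈ ∑ᶠ e (λ u v → (k * hˢ-product α u) * (l * hˢ-product β v))
    expand k l α β = begin
      k * l * hˢ-product (α ++ β) e                                        ≈⟨ *-congˡ (hˢ-product-++ α β e) ⟩
      k * l * ∑ᶠ e (λ u v → hˢ-product α u * hˢ-product β v)               ≈⟨ *-∑ (k * l) (factorizations e) _ ⟩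
      ∑ᶠ e (λ u v → k * l * (hˢ-product α u * hˢ-product β v))             ≈⟨ ∑ᶠ-cong e (λ u v → *-interchange _ _ _ _) ⟩
      ∑ᶠ e (λ u v → (k * hˢ-product α u) * (l * hˢ-product β v))           ∎

  -- Complete homogeneous symmetric functions and power sums

  𝟙-*-cong : {P : Set p} (P? : Dec P) {x y : Carrier} → (P → x ≈ y) → 𝟙 P? * x ≈ 𝟙 P? * y
  𝟙-*-cong (yes P) eq = *-congˡ (eq P)
  𝟙-*-cong (no ¬P) eq = ≈-trans (zeroˡ _) (≈-sym (zeroˡ _))

  monomial≡tabulate : ∀ {m n} (w : Vec (Fin m) n) → monomial w ≡ tabulate (occurrences w)
  monomial≡tabulate w = List.map-tabulate id (occurrences w)

  sum-tabulate : ∀ {n} (f : Fin n → ℕ) → sum (tabulate f) ≡ ∑ℕ.∑ (allFin n) f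
  sum-tabulate f = cong sum (≡.sym (List.map-tabulate id f))

  sum-monomial : ∀ {m n} (w : Vec (Fin m) n) → sum (monomial w) ≡ n
  sum-monomial w = ≡.trans (cong sum (monomial≡tabulate w)) (≡.trans (sum-tabulate (occurrences w)) (∑-occurrences w))

  -- `sortedWord e` is the only weakly increasing word with content e, so in degree n the count is
  -- 1; the content of a word of length n has total n, so in any other degree it is 0.
  hˢ≈𝟙 : ∀ n e → hˢ n e ≈ 𝟙 (sum e ℕ.≟ n)
  hˢ≈𝟙 n e with sum e ℕ.≟ n
  ... | no  sum≢n = ≈-trans (×-congˡ (cong length (List.filter-none (λ w → linked? Fin._≤?_ w ×-dec List.≡-dec ℕ._≟_ (monomial w) e)
    (All.universal (λ { w (_ , eq) → sum≢n (≡.trans (cong sum (≡.sym eq)) (sum-monomial w)) }) (words (allFin (length e)) n)))))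
    (≈-sym (𝟙-no (sum e ℕ.≟ n) sum≢n))
  ... | yes refl  = ≈-trans (×-congˡ (length-singleton (Unique.filter⁺ P? (words-unique n (Unique.allFin⁺ _)))
      (∈-filter⁺ P? (∈-words-allFin w₀) (sortedWord-increasing e , monomial-w₀)) unique))
      (≈-trans (+-identityʳ _) (≈-sym (𝟙-yes (sum e ℕ.≟ sum e) refl)))
    where
    w₀ = sortedWord e
    monomial-w₀ : monomial w₀ ≡ e
    monomial-w₀ = ≡.trans (monomial≡tabulate w₀) (occurrences-sortedWord e)
    P? : Decidable (λ w → Increasing w × monomial w ≡ e)
    P? w = linked? Fin._≤?_ w ×-dec List.≡-dec ℕ._≟_ (monomial w) e
    unique : ∀ {w} → w ∈ filter P? (words (allFin (length e)) (sum e)) → w ≡ w₀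
    unique {w} w∈ with _ , w↗ , eq ← ∈-filter⁻ P? {xs = words (allFin (length e)) (sum e)} w∈ =
      increasing-unique w↗ (sortedWord-increasing e)
        (tabulate-injective (≡.trans (≡.sym (monomial≡tabulate w)) (≡.trans eq (≡.sym (occurrences-sortedWord e)))))

  -- Meaningful only for k ≥ 1, where x₁^i m contributes to the sum of the xⱼ^k
  -- iff either i = k and m = 1, or i = 0 and m contributes.
  powerSum : ℕ → Series
  powerSum k []      = 0#
  powerSum k (i ∷ e) = 𝟙 (i ℕ.≟ k) * 1ˢ e + 𝟙 (i ℕ.≟ 0) * powerSum k e

  -- The sum of the coefficients of f at e - k εⱼ over all j with eⱼ ≥ k.
  shifts : ℕ → Series → Series
  shifts k f []      = 0#
  shifts k f (n ∷ e) = 𝟙 (k ℕ.≤? n) * f (n ∸ k ∷ e) + shifts k (f ∘ (n ∷_)) e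

  shifts-cong : ∀ k {f g} e → (∀ x → length x ≡ length e → f x ≈ g x) → shifts k f e ≈ shifts k g e
  shifts-cong k []      eq = ≈-refl
  shifts-cong k (n ∷ e) eq = +-cong (*-congˡ (eq (n ∸ k ∷ e) refl)) (shifts-cong k e (λ x → eq (n ∷ x) ∘ cong suc))

  shifts-* : ∀ k x f e → shifts k (λ y → x * f y) e ≈ x * shifts k f e
  shifts-* k x f []      = ≈-sym (zeroʳ x)
  shifts-* k x f (n ∷ e) = ≈-trans (+-cong (x*yz≈y*xz _ _ _) (shifts-* k x _ e)) (≈-sym (distribˡ _ _ _))

  shifts-∑ : ∀ k (xs : List A) (f : A → Series) e → shifts k (λ y → ∑ xs (λ x → f x y)) e ≈ ∑ xs (λ x → shifts k (f x) e)
  shifts-∑ k xs f []      = ≈-sym (∑-0 xs)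
  shifts-∑ k xs f (n ∷ e) = ≈-trans (+-cong (*-∑ _ xs _) (shifts-∑ k xs _ e)) (≈-sym (∑-+ xs _ _))

  -- x_j^k times a monomial gives x^e exactly when that monomial is x^e with k removed from the j-th
  -- exponent. In the first variable this is the case i = k; the case i = 0 passes to the remaining
  -- variables.
  powerSum-*ˢ : ∀ k f → powerSum k *ˢ f ≈ˢ shifts k f
  powerSum-*ˢ k f []      = ≈-trans (+-identityʳ _) (zeroˡ _)
  powerSum-*ˢ k f (n ∷ e) = begin
    (powerSum k *ˢ f) (n ∷ e)
      ≈⟨ ∑ᶠ-∷ n e _ ⟩
    antidiagonal n (λ i j → ∑ᶠ e (λ x y → (𝟙 (i ℕ.≟ k) * 1ˢ x + 𝟙 (i ℕ.≟ 0) * powerSum k x) * f (j ∷ y)))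
      ≈⟨ antidiagonal-cong n split ⟩
    antidiagonal n (λ i j → 𝟙 (i ℕ.≟ k) * f (j ∷ e) + 𝟙 (i ℕ.≟ 0) * shifts k (f ∘ (j ∷_)) e)
      ≈⟨ antidiagonal-+ n _ _ ⟩
    antidiagonal n (λ i j → 𝟙 (i ℕ.≟ k) * f (j ∷ e)) + antidiagonal n (λ i j → 𝟙 (i ℕ.≟ 0) * shifts k (f ∘ (j ∷_)) e)
      ≈⟨ +-cong (antidiagonal-𝟙 n k (λ j → f (j ∷ e))) (≈-trans (antidiagonal-𝟙 n 0 (λ j → shifts k (f ∘ (j ∷_)) e)) (*-identityˡ _)) ⟩
    shifts k f (n ∷ e)
      ∎
    where
    split : ∀ i j → ∑ᶠ e (λ x y → (𝟙 (i ℕ.≟ k) * 1ˢ x + 𝟙 (i ℕ.≟ 0) * powerSum k x) * f (j ∷ y)) ≈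
      𝟙 (i ℕ.≟ k) * f (j ∷ e) + 𝟙 (i ℕ.≟ 0) * shifts k (f ∘ (j ∷_)) e
    split i j = begin
      ∑ᶠ e (λ x y → (𝟙 (i ℕ.≟ k) * 1ˢ x + 𝟙 (i ℕ.≟ 0) * powerSum k x) * f (j ∷ y))
        ≈⟨ ∑ᶠ-cong e (λ x y → ≈-trans (distribʳ _ _ _) (+-cong (*-assoc _ _ _) (*-assoc _ _ _))) ⟩
      ∑ᶠ e (λ x y → 𝟙 (i ℕ.≟ k) * (1ˢ x * f (j ∷ y)) + 𝟙 (i ℕ.≟ 0) * (powerSum k x * f (j ∷ y)))
        ≈⟨ ∑-+ (factorizations e) _ _ ⟩
      ∑ᶠ e (λ x y → 𝟙 (i ℕ.≟ k) * (1ˢ x * f (j ∷ y))) + ∑ᶠ e (λ x y → 𝟙 (i ℕ.≟ 0) * (powerSum k x * f (j ∷ y)))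
        ≈⟨ +-cong (*-∑ _ (factorizations e) _) (*-∑ _ (factorizations e) _) ⟨
      𝟙 (i ℕ.≟ k) * (1ˢ *ˢ (f ∘ (j ∷_))) e + 𝟙 (i ℕ.≟ 0) * (powerSum k *ˢ (f ∘ (j ∷_))) e
        ≈⟨ +-cong (*-congˡ (1ˢ-identityˡ _ e)) (*-congˡ (powerSum-*ˢ k (f ∘ (j ∷_)) e)) ⟩
      𝟙 (i ℕ.≟ k) * f (j ∷ e) + 𝟙 (i ℕ.≟ 0) * shifts k (f ∘ (j ∷_)) e
        ∎

  -- Removing k from one exponent lowers the degree by k, so all admissible shifts pass the degree
  -- test together and only their number remains. The parameter c holds the exponents already
  -- passed, since the recursion of `shifts` keeps them in front.
  shifts-homogeneous : ∀ k c d e →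
    shifts k (λ x → 𝟙 (c ℕ.+ sum x ℕ.≟ d)) e ≈ 𝟙 (c ℕ.+ sum e ℕ.≟ k ℕ.+ d) * ∑ e (λ i → 𝟙 (k ℕ.≤? i))
  shifts-homogeneous k c d []      = ≈-sym (zeroʳ _)
  shifts-homogeneous k c d (n ∷ e) = begin
    𝟙 (k ℕ.≤? n) * 𝟙 (c ℕ.+ (n ∸ k ℕ.+ sum e) ℕ.≟ d) + shifts k (λ x → 𝟙 (c ℕ.+ (n ℕ.+ sum x) ℕ.≟ d)) e
      ≈⟨ +-cong (𝟙-*-cong (k ℕ.≤? n) (λ k≤n → 𝟙-⇔ (c ℕ.+ (n ∸ k ℕ.+ sum e) ℕ.≟ d) total?
            (λ eq → ≡.trans (move k≤n) (cong (k ℕ.+_) eq)) (λ eq → ℕ.+-cancelˡ-≡ k _ _ (≡.trans (≡.sym (move k≤n)) eq))))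
          (shifts-cong k e (λ x _ → reflexive (cong (λ s → 𝟙 (s ℕ.≟ d)) (≡.sym (ℕ.+-assoc c n (sum x)))))) ⟩
    𝟙 (k ℕ.≤? n) * 𝟙 total? + shifts k (λ x → 𝟙 (c ℕ.+ n ℕ.+ sum x ℕ.≟ d)) e
      ≈⟨ +-cong (*-comm _ _) (shifts-homogeneous k (c ℕ.+ n) d e) ⟩
    𝟙 total? * 𝟙 (k ℕ.≤? n) + 𝟙 (c ℕ.+ n ℕ.+ sum e ℕ.≟ k ℕ.+ d) * ∑ e (λ i → 𝟙 (k ℕ.≤? i))
      ≈⟨ +-congˡ (*-congʳ (reflexive (cong (λ s → 𝟙 (s ℕ.≟ k ℕ.+ d)) (ℕ.+-assoc c n (sum e))))) ⟩
    𝟙 total? * 𝟙 (k ℕ.≤? n) + 𝟙 total? * ∑ e (λ i → 𝟙 (k ℕ.≤? i))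
      ≈⟨ distribˡ _ _ _ ⟨
    𝟙 total? * ∑ (n ∷ e) (λ i → 𝟙 (k ℕ.≤? i))
      ∎
    where
    total? = c ℕ.+ (n ℕ.+ sum e) ℕ.≟ k ℕ.+ d
    open CommutativeSemigroupProperties ℕ.+-commutativeSemigroup using (x∙yz≈y∙xz)
    move : k ≤ n → c ℕ.+ (n ℕ.+ sum e) ≡ k ℕ.+ (c ℕ.+ (n ∸ k ℕ.+ sum e))
    move k≤n = ≡.trans (cong (λ s → c ℕ.+ (s ℕ.+ sum e)) (≡.sym (ℕ.m+[n∸m]≡n k≤n)))
      (≡.trans (cong (c ℕ.+_) (ℕ.+-assoc k (n ∸ k) (sum e))) (x∙yz≈y∙xz c k _))

  powerSum-*ˢ-hˢ : ∀ k n e → (powerSum k *ˢ hˢ n) e ≈ 𝟙 (sum e ℕ.≟ k ℕ.+ n) * ∑ e (λ i → 𝟙 (k ℕ.≤? i))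
  powerSum-*ˢ-hˢ k n e = ≈-trans (powerSum-*ˢ k (hˢ n) e)
    (≈-trans (shifts-cong k e (λ x _ → hˢ≈𝟙 n x)) (shifts-homogeneous k 0 n e))

  powerSum≈ : ∀ k e → powerSum k e ≈ 𝟙 (sum e ℕ.≟ k) * ∑ e (λ i → 𝟙 (k ℕ.≤? i))
  powerSum≈ k e = begin
    powerSum k e                                             ≈⟨ 1ˢ-identityʳ (powerSum k) e ⟨
    (powerSum k *ˢ 1ˢ) e                                     ≈⟨ powerSum-*ˢ k 1ˢ e ⟩
    shifts k 1ˢ e                                            ≈⟨ shifts-homogeneous k 0 0 e ⟩
    𝟙 (sum e ℕ.≟ k ℕ.+ 0) * ∑ e (λ i → 𝟙 (k ℕ.≤? i))         ≈⟨ *-congʳ (reflexive (cong (λ s → 𝟙 (sum e ℕ.≟ s)) (ℕ.+-identityʳ k))) ⟩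
    𝟙 (sum e ℕ.≟ k) * ∑ e (λ i → 𝟙 (k ℕ.≤? i))               ∎

  -- `i ∸ n` counts the k with n < k ≤ i; the value k = n + 1 is split off.
  ∸·1 : ∀ i n → (i ∸ n) · 1# ≈ 𝟙 (suc n ℕ.≤? i) + (i ∸ suc n) · 1#
  ∸·1 zero    zero    = ≈-sym (+-identityˡ _)
  ∸·1 zero    (suc n) = ≈-sym (+-identityˡ _)
  ∸·1 (suc i) zero    = ≈-refl
  ∸·1 (suc i) (suc n) = ≈-trans (∸·1 i n) (+-congʳ (𝟙-⇔ (suc n ℕ.≤? i) (suc (suc n) ℕ.≤? suc i) s≤s ℕ.s≤s⁻¹))

  ∑·1 : ∀ e → ∑ e (_· 1#) ≈ sum e · 1#
  ∑·1 []      = ≈-refl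
  ∑·1 (i ∷ e) = ≈-trans (+-congˡ (∑·1 e)) (≈-sym (×-homo-+ 1# i (sum e)))

  ∈⇒≤sum : ∀ {i e} → i ∈ e → i ≤ sum e
  ∈⇒≤sum {e = j ∷ e} (here refl) = ℕ.m≤m+n j (sum e)
  ∈⇒≤sum {e = j ∷ e} (there i∈)  = ℕ.≤-trans (∈⇒≤sum i∈) (ℕ.m≤n+m (sum e) j)

  -- The coefficients of Σ_{b < a} h_b p_{a+n-b}: the exponent i contributes
  -- one for each b < a with a + n - b ≤ i.
  newton : ℕ → ℕ → Series
  newton a n e = 𝟙 (sum e ℕ.≟ a ℕ.+ n) * ∑ e (λ i → (i ∸ n) · 1#)

  -- In degree n + 1 no exponent exceeds n + 1, so `i ∸ n` is merely the indicator of i ≥ n + 1.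
  newton-1 : ∀ n → newton 1 n ≈ˢ powerSum (suc n)
  newton-1 n e = ≈-trans
    (𝟙-*-cong (sum e ℕ.≟ suc n) (λ sum≡ → ∑-cong∈ e (λ {i} i∈ → begin
      (i ∸ n) · 1#                                ≈⟨ ∸·1 i n ⟩
      𝟙 (suc n ℕ.≤? i) + (i ∸ suc n) · 1#         ≈⟨ +-congˡ (×-congˡ (ℕ.m≤n⇒m∸n≡0 (ℕ.≤-trans (∈⇒≤sum i∈) (ℕ.≤-reflexive sum≡)))) ⟩
      𝟙 (suc n ℕ.≤? i) + 0#                       ≈⟨ +-identityʳ _ ⟩
      𝟙 (suc n ℕ.≤? i)                            ∎)))
    (≈-sym (powerSum≈ (suc n) e))

  -- The two `newton` terms have the same degree and differ by the summand b = a, which is h_a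
  -- p_{n+1}; its coefficient counts the exponents that are at least n + 1.
  newton-step : ∀ a n e → newton (suc a) n e ≈ (hˢ a *ˢ powerSum (suc n)) e + newton a (suc n) e
  newton-step a n e = begin
    𝟙 (sum e ℕ.≟ suc a ℕ.+ n) * ∑ e (λ i → (i ∸ n) · 1#)
      ≈⟨ *-cong (reflexive (cong (λ s → 𝟙 (sum e ℕ.≟ s)) (≡.sym (ℕ.+-suc a n)))) (≈-trans (∑-cong e (λ i → ∸·1 i n)) (∑-+ e _ _)) ⟩
    𝟙 (sum e ℕ.≟ a ℕ.+ suc n) * (∑ e (λ i → 𝟙 (suc n ℕ.≤? i)) + ∑ e (λ i → (i ∸ suc n) · 1#))
      ≈⟨ distribˡ _ _ _ ⟩
    𝟙 (sum e ℕ.≟ a ℕ.+ suc n) * ∑ e (λ i → 𝟙 (suc n ℕ.≤? i)) + newton a (suc n) e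
      ≈⟨ +-congʳ (*-congʳ (reflexive (cong (λ s → 𝟙 (sum e ℕ.≟ s)) (ℕ.+-comm a (suc n))))) ⟩
    𝟙 (sum e ℕ.≟ suc n ℕ.+ a) * ∑ e (λ i → 𝟙 (suc n ℕ.≤? i)) + newton a (suc n) e
      ≈⟨ +-congʳ (powerSum-*ˢ-hˢ (suc n) a e) ⟨
    (powerSum (suc n) *ˢ hˢ a) e + newton a (suc n) e
      ≈⟨ +-congʳ (*ˢ-comm (powerSum (suc n)) (hˢ a) e) ⟩
    (hˢ a *ˢ powerSum (suc n)) e + newton a (suc n) e
      ∎

  -- (-1)^(ℓ(β) - 1) times the last part of β.
  ΨCoefficient : Composition → Carrier
  ΨCoefficient []          = 0#
  ΨCoefficient (a ∷ [])    = value a · 1#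
  ΨCoefficient (_ ∷ b ∷ β) = - ΨCoefficient (b ∷ β)

  ΨCoefficient-∷ : ∀ a {β} → NonEmpty β → ΨCoefficient (a ∷ β) ≈ - ΨCoefficient β
  ΨCoefficient-∷ a (cons _ _) = ≈-refl

  -- The contribution to the image of Ψ_{a+n} of the compositions with first part at least a. For a
  -- = 1 it is the whole image; general a is what the recursion of `compositionsFrom` requires.
  Ψˢ : (a : ℕ) .{{_ : NonZero a}} → ℕ → Series
  Ψˢ a n e = ∑ (compositionsFrom a n) (λ β → ΨCoefficient β * hˢ-product β e)

  -- The first part is either a or larger. Prepending a to a nonempty composition keeps its last
  -- part and changes the parity of its length, which gives the minus sign.
  Ψˢ-suc : ∀ a .{{_ : NonZero a}} n e → Ψˢ a (suc n) e ≈ - (hˢ a *ˢ Ψˢ 1 n) e + Ψˢ (suc a) n e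
  Ψˢ-suc a n e = begin
    Ψˢ a (suc n) e
      ≈⟨ ∑-++ (map (pos a ∷_) Γ) _ _ ⟩
    ∑ (map (pos a ∷_) Γ) (λ β → ΨCoefficient β * hˢ-product β e) + Ψˢ (suc a) n e
      ≈⟨ +-congʳ (∑-map (pos a ∷_) Γ _) ⟩
    ∑ Γ (λ γ → ΨCoefficient (pos a ∷ γ) * ∑ᶠ e (λ x y → hˢ a x * hˢ-product γ y)) + Ψˢ (suc a) n e
      ≈⟨ +-congʳ (∑-cong∈ Γ (λ {γ} γ∈ → expand γ (proj₁ (∈-compositionsFrom 1 n γ∈)))) ⟩
    ∑ Γ (λ γ → - 1# * ∑ᶠ e (λ x y → hˢ a x * (ΨCoefficient γ * hˢ-product γ y))) + Ψˢ (suc a) n e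
      ≈⟨ +-congʳ (≈-trans (≈-sym (*-∑ (- 1#) Γ _)) (-1*x≈-x _)) ⟩
    - ∑ Γ (λ γ → ∑ᶠ e (λ x y → hˢ a x * (ΨCoefficient γ * hˢ-product γ y))) + Ψˢ (suc a) n e
      ≈⟨ +-congʳ (-‿cong (≈-trans (∑-swap Γ (factorizations e) _) (∑ᶠ-cong e (λ x y → ≈-sym (*-∑ (hˢ a x) Γ _))))) ⟩
    - (hˢ a *ˢ Ψˢ 1 n) e + Ψˢ (suc a) n e
      ∎
    where
    Γ = compositionsFrom 1 n
    expand : ∀ γ → NonEmpty γ → ΨCoefficient (pos a ∷ γ) * ∑ᶠ e (λ x y → hˢ a x * hˢ-product γ y) ≈
      - 1# * ∑ᶠ e (λ x y → hˢ a x * (ΨCoefficient γ * hˢ-product γ y))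
    expand γ ne = begin
      ΨCoefficient (pos a ∷ γ) * ∑ᶠ e (λ x y → hˢ a x * hˢ-product γ y)
        ≈⟨ *-congʳ (≈-trans (ΨCoefficient-∷ (pos a) ne) (≈-sym (-1*x≈-x _))) ⟩
      - 1# * ΨCoefficient γ * ∑ᶠ e (λ x y → hˢ a x * hˢ-product γ y)
        ≈⟨ *-assoc _ _ _ ⟩
      - 1# * (ΨCoefficient γ * ∑ᶠ e (λ x y → hˢ a x * hˢ-product γ y))
        ≈⟨ *-congˡ (≈-trans (*-∑ _ (factorizations e) _) (∑ᶠ-cong e (λ x y → x*yz≈y*xz _ _ _))) ⟩
      - 1# * ∑ᶠ e (λ x y → hˢ a x * (ΨCoefficient γ * hˢ-product γ y))
        ∎

  -- Induction on n for all a at once. At n = 0 only the composition (a) occurs, and the claim says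
  -- that the exponents of a monomial of degree a add up to a. In the step, the instance a = 1
  -- identifies the inner factor as p_{n+1}, and the terms h_a p_{n+1} of `Ψˢ-suc` and `newton-step`
  -- cancel.
  Ψˢ≈newton : ∀ a .{{_ : NonZero a}} n → Ψˢ a n ≈ˢ newton a n
  Ψˢ≈newton a zero e = begin
    a · 1# * hˢ-product (pos a ∷ []) e + 0#        ≈⟨ +-identityʳ _ ⟩
    a · 1# * (hˢ a *ˢ 1ˢ) e                        ≈⟨ *-congˡ (≈-trans (1ˢ-identityʳ (hˢ a) e) (hˢ≈𝟙 a e)) ⟩
    a · 1# * 𝟙 (sum e ℕ.≟ a)                       ≈⟨ *-comm _ _ ⟩
    𝟙 (sum e ℕ.≟ a) * a · 1#                       ≈⟨ 𝟙-*-cong (sum e ℕ.≟ a) (λ { refl → ≈-sym (∑·1 e) }) ⟩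
    𝟙 (sum e ℕ.≟ a) * ∑ e (_· 1#)                  ≈⟨ *-congʳ (reflexive (cong (λ s → 𝟙 (sum e ℕ.≟ s)) (≡.sym (ℕ.+-identityʳ a)))) ⟩
    newton a 0 e                                   ∎
  Ψˢ≈newton a (suc n) e = begin
    Ψˢ a (suc n) e
      ≈⟨ Ψˢ-suc a n e ⟩
    - (hˢ a *ˢ Ψˢ 1 n) e + Ψˢ (suc a) n e
      ≈⟨ +-cong (-‿cong (*ˢ-cong (λ _ → ≈-refl) (λ x → ≈-trans (Ψˢ≈newton 1 n x) (newton-1 n x)) e)) (Ψˢ≈newton (suc a) n e) ⟩
    - (hˢ a *ˢ powerSum (suc n)) e + newton (suc a) n e
      ≈⟨ +-congˡ (newton-step a n e) ⟩
    - (hˢ a *ˢ powerSum (suc n)) e + ((hˢ a *ˢ powerSum (suc n)) e + newton a (suc n) e)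
      ≈⟨ +-assoc _ _ _ ⟨
    - (hˢ a *ˢ powerSum (suc n)) e + (hˢ a *ˢ powerSum (suc n)) e + newton a (suc n) e
      ≈⟨ ≈-trans (+-congʳ (-‿inverseˡ _)) (+-identityˡ _) ⟩
    newton a (suc n) e
      ∎

  -- The image of Ψₙ

  sign-square : ∀ n → [-1]^ n * [-1]^ n ≈ 1#
  sign-square zero    = *-identityˡ 1#
  sign-square (suc n) = begin
    (- 1# * [-1]^ n) * (- 1# * [-1]^ n)    ≈⟨ *-interchange _ _ _ _ ⟩
    (- 1# * - 1#) * ([-1]^ n * [-1]^ n)    ≈⟨ *-cong (≈-trans (-1*x≈-x _) (-‿involutive 1#)) (sign-square n) ⟩
    1# * 1#                                ≈⟨ *-identityˡ 1# ⟩
    1#                                     ∎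

  sign-∸ : ∀ {m n} → m ≤ n → [-1]^ n * [-1]^ (n ∸ m) ≈ [-1]^ m
  sign-∸ {m} {n} m≤n = begin
    [-1]^ n * [-1]^ (n ∸ m)                    ≈⟨ *-congʳ (reflexive (cong [-1]^_ (≡.sym (ℕ.m+[n∸m]≡n m≤n)))) ⟩
    [-1]^ (m ℕ.+ (n ∸ m)) * [-1]^ (n ∸ m)      ≈⟨ *-congʳ (^-homo-* (- 1#) m (n ∸ m)) ⟩
    [-1]^ m * [-1]^ (n ∸ m) * [-1]^ (n ∸ m)    ≈⟨ *-assoc _ _ _ ⟩
    [-1]^ m * ([-1]^ (n ∸ m) * [-1]^ (n ∸ m))  ≈⟨ *-congˡ (sign-square (n ∸ m)) ⟩
    [-1]^ m * 1#                               ≈⟨ *-identityʳ _ ⟩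
    [-1]^ m                                    ∎

  φ-R : ∀ α e → φ (R α) e ≈
    ∑ (compositions ∣ α ∣ᶜ) (λ β → 𝟙 (β ≥ᶜ? α) * ([-1]^ (length α ∸ length β) * hˢ-product β e))
  φ-R α e = begin
    φ (R α) e
      ≈⟨ φ-∑ (filter (_≥ᶜ? α) (compositions ∣ α ∣ᶜ)) _ e ⟩
    ∑ (filter (_≥ᶜ? α) (compositions ∣ α ∣ᶜ)) (λ β → φ ([-1]^ (length α ∸ length β) • H β) e)
      ≈⟨ ∑-cong (filter (_≥ᶜ? α) (compositions ∣ α ∣ᶜ)) (λ β → ≈-trans (φ-• _ (H β) e) (*-congˡ (φ-H β e))) ⟩
    ∑ (filter (_≥ᶜ? α) (compositions ∣ α ∣ᶜ)) (λ β → [-1]^ (length α ∸ length β) * hˢ-product β e)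
      ≈⟨ ∑-filter (_≥ᶜ? α) (compositions ∣ α ∣ᶜ) _ ⟩
    ∑ (compositions ∣ α ∣ᶜ) (λ β → 𝟙 (β ≥ᶜ? α) * ([-1]^ (length α ∸ length β) * hˢ-product β e))
      ∎

  ∑-upTo-𝟙≤ : ∀ n m → ∑ (upTo n) (λ i → 𝟙 (m ℕ.≤? i)) ≈ (n ∸ m) · 1#
  ∑-upTo-𝟙≤ zero    m       = ×-congˡ (≡.sym (ℕ.0∸n≡0 m))
  ∑-upTo-𝟙≤ (suc n) zero    = ≈-trans (∑-upTo-suc n (λ i → 𝟙 (0 ℕ.≤? i))) (+-congˡ (∑-upTo-𝟙≤ n 0))
  ∑-upTo-𝟙≤ (suc n) (suc m) = begin
    ∑ (upTo (suc n)) (λ i → 𝟙 (suc m ℕ.≤? i))          ≈⟨ ∑-upTo-suc n (λ i → 𝟙 (suc m ℕ.≤? i)) ⟩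
    0# + ∑ (upTo n) (λ i → 𝟙 (suc m ℕ.≤? suc i))       ≈⟨ +-identityˡ _ ⟩
    ∑ (upTo n) (λ i → 𝟙 (suc m ℕ.≤? suc i))            ≈⟨ ∑-cong (upTo n) (λ i → 𝟙-⇔ (suc m ℕ.≤? suc i) (m ℕ.≤? i) ℕ.s≤s⁻¹ s≤s) ⟩
    ∑ (upTo n) (λ i → 𝟙 (m ℕ.≤? i))                    ≈⟨ ∑-upTo-𝟙≤ n m ⟩
    (n ∸ m) · 1#                                       ∎

  -- The difference is the last part. Written this way it is also the number of i with `initSum` ≤ i
  -- < n, where n is the size of the composition, which is how the hooks produce it.
  ΨCoefficient≈ : ∀ a β → ΨCoefficient (a ∷ β) ≈ (∣ a ∷ β ∣ᶜ ∸ initSum (a ∷ β)) · 1# * [-1]^ (length β)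
  ΨCoefficient≈ a []      = ≈-trans (×-congˡ (≡.sym (ℕ.+-identityʳ (value a)))) (≈-sym (*-identityʳ _))
  ΨCoefficient≈ a (b ∷ β) = begin
    - ΨCoefficient (b ∷ β)
      ≈⟨ -1*x≈-x _ ⟨
    - 1# * ΨCoefficient (b ∷ β)
      ≈⟨ *-congˡ (ΨCoefficient≈ b β) ⟩
    - 1# * ((∣ b ∷ β ∣ᶜ ∸ initSum (b ∷ β)) · 1# * [-1]^ (length β))
      ≈⟨ x*yz≈y*xz _ _ _ ⟩
    (∣ b ∷ β ∣ᶜ ∸ initSum (b ∷ β)) · 1# * (- 1# * [-1]^ (length β))
      ≈⟨ *-congʳ (×-congˡ (≡.sym (ℕ.[m+n]∸[m+o]≡n∸o (value a) ∣ b ∷ β ∣ᶜ (initSum (b ∷ β))))) ⟩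
    (∣ a ∷ b ∷ β ∣ᶜ ∸ initSum (a ∷ b ∷ β)) · 1# * (- 1# * [-1]^ (length β))
      ∎

  -- β ≥ (1ⁱ, n - i) holds for exactly those i < n with initSum β ≤ i, and the
  -- corresponding terms of Ψₙ all have the same sign.
  hooks-coefficient : ∀ n a β → ∣ a ∷ β ∣ᶜ ≡ n → ∀ x →
    ∑ (allFin n) (λ i → [-1]^ (toℕ i) * (𝟙 ((a ∷ β) ≥ᶜ? hook n i) * ([-1]^ (length (hook n i) ∸ suc (length β)) * x)))
      ≈ ΨCoefficient (a ∷ β) * x
  hooks-coefficient n a β refl x = begin
    ∑ (allFin n) (λ i → [-1]^ (toℕ i) * (𝟙 ((a ∷ β) ≥ᶜ? hook n i) * ([-1]^ (length (hook n i) ∸ suc (length β)) * x)))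
      ≈⟨ ∑-cong (allFin n) term ⟩
    ∑ (allFin n) (λ i → 𝟙 (initSum (a ∷ β) ℕ.≤? toℕ i) * ([-1]^ (length β) * x))
      ≈⟨ ∑-allFin-toℕ n (λ i → 𝟙 (initSum (a ∷ β) ℕ.≤? i) * ([-1]^ (length β) * x)) ⟩
    ∑ (upTo n) (λ i → 𝟙 (initSum (a ∷ β) ℕ.≤? i) * ([-1]^ (length β) * x))
      ≈⟨ ∑-* _ (upTo n) _ ⟨
    ∑ (upTo n) (λ i → 𝟙 (initSum (a ∷ β) ℕ.≤? i)) * ([-1]^ (length β) * x)
      ≈⟨ *-congʳ (∑-upTo-𝟙≤ n (initSum (a ∷ β))) ⟩
    (n ∸ initSum (a ∷ β)) · 1# * ([-1]^ (length β) * x)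
      ≈⟨ ≈-trans (≈-sym (*-assoc _ _ _)) (*-congʳ (≈-sym (ΨCoefficient≈ a β))) ⟩
    ΨCoefficient (a ∷ β) * x
      ∎
    where
    length-hook : ∀ i → length (hook n i) ≡ suc (toℕ i)
    length-hook i = ≡.trans (List.length-++ (replicate (toℕ i) (pos 1)))
      (≡.trans (cong (ℕ._+ 1) (List.length-replicate (toℕ i))) (ℕ.+-comm (toℕ i) 1))
    term : ∀ i → [-1]^ (toℕ i) * (𝟙 ((a ∷ β) ≥ᶜ? hook n i) * ([-1]^ (length (hook n i) ∸ suc (length β)) * x)) ≈
      𝟙 (initSum (a ∷ β) ℕ.≤? toℕ i) * ([-1]^ (length β) * x)
    term i = begin
      [-1]^ (toℕ i) * (𝟙 ((a ∷ β) ≥ᶜ? hook n i) * ([-1]^ (length (hook n i) ∸ suc (length β)) * x))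
        ≈⟨ x*yz≈y*xz _ _ _ ⟩
      𝟙 ((a ∷ β) ≥ᶜ? hook n i) * ([-1]^ (toℕ i) * ([-1]^ (length (hook n i) ∸ suc (length β)) * x))
        ≈⟨ *-congʳ (𝟙-⇔ ((a ∷ β) ≥ᶜ? hook n i) (initSum (a ∷ β) ℕ.≤? toℕ i) (≥ᶜ-hook⁻ (a ∷ β) (toℕ i))
             (≥ᶜ-hook⁺ (a ∷ β) (toℕ i) (≡.sym (ℕ.m+[n∸m]≡n (ℕ.<⇒≤ (Fin.toℕ<n i)))))) ⟩
      𝟙 (initSum (a ∷ β) ℕ.≤? toℕ i) * ([-1]^ (toℕ i) * ([-1]^ (length (hook n i) ∸ suc (length β)) * x))
        -- The hook has i + 1 parts, so the exponent is i minus `length β`, exact because `length β`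
        -- ≤ `initSum (a ∷ β)` ≤ i. Multiplying by (-1)^i leaves (-1)^`length β`, free of i.
        ≈⟨ 𝟙-*-cong (initSum (a ∷ β) ℕ.≤? toℕ i) (λ init≤i → ≈-trans
             (*-congˡ (*-congʳ (reflexive (cong (λ l → [-1]^ (l ∸ suc (length β))) (length-hook i)))))
             (≈-trans (≈-sym (*-assoc _ _ _)) (*-congʳ (sign-∸ (ℕ.≤-trans (ℕ.s≤s⁻¹ (length≤1+initSum (a ∷ β))) init≤i))))) ⟩
      𝟙 (initSum (a ∷ β) ℕ.≤? toℕ i) * ([-1]^ (length β) * x)
        ∎

  φ-Ψ : ∀ a → φ (Ψ a) ≈ˢ powerSum (value a)
  φ-Ψ (pos (suc n)) e = begin
    φ (Ψ (pos m)) e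
      ≈⟨ φ-∑ (allFin m) (λ i → [-1]^ (toℕ i) • R (hook m i)) e ⟩
    ∑ (allFin m) (λ i → φ ([-1]^ (toℕ i) • R (hook m i)) e)
      ≈⟨ ∑-cong (allFin m) (λ i → ≈-trans (φ-• _ (R (hook m i)) e) (*-congˡ (≈-trans (φ-R (hook m i) e) (∣hook∣≡m i)))) ⟩
    ∑ (allFin m) (λ i → [-1]^ (toℕ i) * ∑ (compositions m) (ribbonTerm i))
      ≈⟨ ∑-cong (allFin m) (λ i → *-∑ _ (compositions m) _) ⟩
    ∑ (allFin m) (λ i → ∑ (compositions m) (λ β → [-1]^ (toℕ i) * ribbonTerm i β))
      ≈⟨ ∑-swap (allFin m) (compositions m) _ ⟩
    ∑ (compositions m) (λ β → ∑ (allFin m) (λ i → [-1]^ (toℕ i) * ribbonTerm i β))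
      ≈⟨ ∑-cong∈ (compositions m) (λ β∈ → collect (∈-compositionsFrom 1 n β∈)) ⟩
    Ψˢ 1 n e
      ≈⟨ Ψˢ≈newton 1 n e ⟩
    newton 1 n e
      ≈⟨ newton-1 n e ⟩
    powerSum m e
      ∎
    where
    m = suc n
    ribbonTerm : Fin m → Composition → Carrier
    ribbonTerm i β = 𝟙 (β ≥ᶜ? hook m i) * ([-1]^ (length (hook m i) ∸ length β) * hˢ-product β e)
    ∣hook∣≡m : ∀ i → ∑ (compositions ∣ hook m i ∣ᶜ) (ribbonTerm i) ≈ ∑ (compositions m) (ribbonTerm i)
    ∣hook∣≡m i = reflexive (cong (λ k → ∑ (compositions k) (ribbonTerm i))
      (≡.trans (∣hook∣ (toℕ i) _) (ℕ.m+[n∸m]≡n (ℕ.<⇒≤ (Fin.toℕ<n i)))))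
    collect : ∀ {β} → NonEmpty β × ∣ β ∣ᶜ ≡ m →
      ∑ (allFin m) (λ i → [-1]^ (toℕ i) * ribbonTerm i β) ≈ ΨCoefficient β * hˢ-product β e
    collect (cons a β , eq) = hooks-coefficient m a β eq (hˢ-product (a ∷ β) e)

  -- The size function is a parameter so that the same product can be indexed by the parts of α(S)
  -- or by the components themselves.
  powerSumProduct : (A → ℕ) → List A → Series
  powerSumProduct size = foldr (λ x f → powerSum (size x) *ˢ f) 1ˢ

  φ-Ψᶜ : ∀ α → φ (Ψᶜ α) ≈ˢ powerSumProduct value α
  φ-Ψᶜ []      e = φ-H [] e
  φ-Ψᶜ (a ∷ α) e = ≈-trans (φ-*ᴺ (Ψ a) (Ψᶜ α) e) (*ˢ-cong (φ-Ψ a) (φ-Ψᶜ α) e)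

  -- Power sums as sums over colourings

  infix 4 _≟ᴹ_
  _≟ᴹ_ : (x y : Monomial) → Dec (x ≡ y)
  _≟ᴹ_ = List.≡-dec ℕ._≟_

  𝟙-∷ : ∀ x e y f → 𝟙 (x ∷ e ≟ᴹ y ∷ f) ≈ 𝟙 (x ℕ.≟ y) * 𝟙 (e ≟ᴹ f)
  𝟙-∷ x e y f = ≈-trans (𝟙-⇔ (x ∷ e ≟ᴹ y ∷ f) ((x ℕ.≟ y) ×-dec (e ≟ᴹ f)) List.∷-injective (uncurry (cong₂ _∷_))) (𝟙-× (x ℕ.≟ y) (e ≟ᴹ f))

  -- Removing k from the j-th exponent of e yields g exactly when adding k to the j-th exponent of g
  -- yields e. The sum over shifts of e thus becomes a sum over the terms of p_k times the monomial
  -- g.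
  shifts-𝟙 : ∀ k e (g : Fin (length e) → ℕ) →
    shifts k (λ x → 𝟙 (tabulate g ≟ᴹ x)) e ≈
    ∑ (allFin (length e)) (λ j → 𝟙 (tabulate (λ i → ∑ℕ.𝟙 (i Fin.≟ j) ℕ.* k ℕ.+ g i) ≟ᴹ e))
  shifts-𝟙 k []      g = ≈-refl
  shifts-𝟙 k (n ∷ e) g = begin
    𝟙 (k ℕ.≤? n) * 𝟙 (tabulate g ≟ᴹ n ∸ k ∷ e) + shifts k (λ x → 𝟙 (tabulate g ≟ᴹ n ∷ x)) e
      ≈⟨ +-cong here-term there-terms ⟩
    𝟙 (bumped zero ≟ᴹ n ∷ e) + ∑ (allFin (length e)) (λ j → 𝟙 (bumped (suc j) ≟ᴹ n ∷ e))
      ≈⟨ ∑-allFin-suc (length e) (λ j → 𝟙 (bumped j ≟ᴹ n ∷ e)) ⟨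
    ∑ (allFin (suc (length e))) (λ j → 𝟙 (bumped j ≟ᴹ n ∷ e))
      ∎
    where
    bumped : Fin (suc (length e)) → List ℕ
    bumped j = tabulate (λ i → ∑ℕ.𝟙 (i Fin.≟ j) ℕ.* k ℕ.+ g i)
    bumped-zero : bumped zero ≡ k ℕ.+ g zero ∷ tabulate (g ∘ suc)
    bumped-zero = cong (λ l → l ℕ.+ g zero ∷ tabulate (g ∘ suc)) (ℕ.*-identityˡ k)
    here-term : 𝟙 (k ℕ.≤? n) * 𝟙 (tabulate g ≟ᴹ n ∸ k ∷ e) ≈ 𝟙 (bumped zero ≟ᴹ n ∷ e)
    here-term = ≈-trans (≈-sym (𝟙-× (k ℕ.≤? n) (tabulate g ≟ᴹ n ∸ k ∷ e)))
      (𝟙-⇔ ((k ℕ.≤? n) ×-dec (tabulate g ≟ᴹ n ∸ k ∷ e)) (bumped zero ≟ᴹ n ∷ e)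
        (λ (k≤n , eq) → ≡.trans bumped-zero (cong₂ _∷_
          (≡.trans (cong (k ℕ.+_) (List.∷-injectiveˡ eq)) (ℕ.m+[n∸m]≡n k≤n)) (List.∷-injectiveʳ eq)))
        (λ eq → let k+g≡n , rest = List.∷-injective (≡.trans (≡.sym bumped-zero) eq) in
          ℕ.≤-trans (ℕ.m≤m+n k (g zero)) (ℕ.≤-reflexive k+g≡n) ,
          cong₂ _∷_ (≡.trans (≡.sym (ℕ.m+n∸m≡n k (g zero))) (cong (_∸ k) k+g≡n)) rest))
    suc≟suc : ∀ {m} (i j : Fin m) → ∑ℕ.𝟙 (suc i Fin.≟ suc j) ≡ ∑ℕ.𝟙 (i Fin.≟ j)
    suc≟suc i j = ∑ℕ.𝟙-⇔ (suc i Fin.≟ suc j) (i Fin.≟ j) Fin.suc-injective (cong suc)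
    there-terms : shifts k (λ x → 𝟙 (tabulate g ≟ᴹ n ∷ x)) e ≈
      ∑ (allFin (length e)) (λ j → 𝟙 (bumped (suc j) ≟ᴹ n ∷ e))
    there-terms = begin
      shifts k (λ x → 𝟙 (tabulate g ≟ᴹ n ∷ x)) e
        ≈⟨ shifts-cong k e (λ x _ → 𝟙-∷ (g zero) (tabulate (g ∘ suc)) n x) ⟩
      shifts k (λ x → 𝟙 (g zero ℕ.≟ n) * 𝟙 (tabulate (g ∘ suc) ≟ᴹ x)) e
        ≈⟨ shifts-* k _ _ e ⟩
      𝟙 (g zero ℕ.≟ n) * shifts k (λ x → 𝟙 (tabulate (g ∘ suc) ≟ᴹ x)) e
        ≈⟨ *-congˡ (shifts-𝟙 k e (g ∘ suc)) ⟩
      𝟙 (g zero ℕ.≟ n) * ∑ (allFin (length e)) (λ j → 𝟙 (tabulate (λ i → ∑ℕ.𝟙 (i Fin.≟ j) ℕ.* k ℕ.+ g (suc i)) ≟ᴹ e))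
        ≈⟨ *-∑ _ (allFin (length e)) _ ⟩
      ∑ (allFin (length e)) (λ j → 𝟙 (g zero ℕ.≟ n) * 𝟙 (tabulate (λ i → ∑ℕ.𝟙 (i Fin.≟ j) ℕ.* k ℕ.+ g (suc i)) ≟ᴹ e))
        ≈⟨ ∑-cong (allFin (length e)) (λ j → ≈-trans (≈-sym (𝟙-∷ (g zero) (tabulate (λ i → ∑ℕ.𝟙 (i Fin.≟ j) ℕ.* k ℕ.+ g (suc i))) n e))
             (reflexive (cong (λ l → 𝟙 (g zero ∷ l ≟ᴹ n ∷ e))
               (List.tabulate-cong (λ i → cong (λ l → l ℕ.* k ℕ.+ g (suc i)) (≡.sym (suc≟suc i j))))))) ⟩
      ∑ (allFin (length e)) (λ j → 𝟙 (bumped (suc j) ≟ᴹ n ∷ e))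
        ∎

  tabulate-0 : ∀ e → 𝟙 (tabulate {n = length e} (λ _ → 0) ≟ᴹ e) ≈ 1ˢ e
  tabulate-0 []      = ≈-refl
  tabulate-0 (n ∷ e) = ≈-trans (𝟙-∷ 0 (tabulate {n = length e} (λ _ → 0)) n e) (≈-trans (*-cong (𝟙-⇔ (0 ℕ.≟ n) (n ℕ.≟ 0) ≡.sym ≡.sym) (tabulate-0 e)) (≈-sym (1ˢ-∷ n e)))

  -- Expanding the product picks one variable per factor, recorded by the word d. The number of
  -- variables is a separate m because the induction hypothesis is applied to shifted monomials,
  -- whose length equals that of e only propositionally.
  powerSumProduct≈ : ∀ {m} (size : A → ℕ) xs e → length e ≡ m → powerSumProduct size xs e ≈
    ∑ (words (allFin m) (length xs)) (λ d → 𝟙 (tabulate (content size xs d) ≟ᴹ e))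
  powerSumProduct≈ size []       e refl = ≈-sym (≈-trans (+-identityʳ _) (tabulate-0 e))
  powerSumProduct≈ size (x ∷ xs) e refl = begin
    (powerSum (size x) *ˢ powerSumProduct size xs) e
      ≈⟨ powerSum-*ˢ (size x) (powerSumProduct size xs) e ⟩
    shifts (size x) (powerSumProduct size xs) e
      ≈⟨ shifts-cong (size x) e (powerSumProduct≈ size xs) ⟩
    shifts (size x) (λ y → ∑ W (λ d → 𝟙 (tabulate (content size xs d) ≟ᴹ y))) e
      ≈⟨ shifts-∑ (size x) W _ e ⟩
    ∑ W (λ d → shifts (size x) (λ y → 𝟙 (tabulate (content size xs d) ≟ᴹ y)) e)
      ≈⟨ ∑-cong W (λ d → shifts-𝟙 (size x) e (content size xs d)) ⟩
    ∑ W (λ d → ∑ (allFin (length e)) (λ j → 𝟙 (tabulate (content size (x ∷ xs) (j ∷ d)) ≟ᴹ e)))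
      ≈⟨ ∑-swap W (allFin (length e)) _ ⟩
    ∑ (allFin (length e)) (λ j → ∑ W (λ d → 𝟙 (tabulate (content size (x ∷ xs) (j ∷ d)) ≟ᴹ e)))
      ≈⟨ ∑-cartesianProductWith Vec._∷_ (allFin (length e)) W _ ⟨
    ∑ (words (allFin (length e)) (suc (length xs))) (λ d → 𝟙 (tabulate (content size (x ∷ xs) d) ≟ᴹ e))
      ∎
    where W = words (allFin (length e)) (length xs)

  -- Inclusion–exclusion

  length-filter·1 : {P : Pred A p} (P? : Decidable P) (xs : List A) → length (filter P? xs) · 1# ≈ ∑ xs (𝟙 ∘ P?)
  length-filter·1 P? []       = ≈-refl
  length-filter·1 P? (x ∷ xs) with does (P? x)
  ... | true  = +-congˡ (length-filter·1 P? xs)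
  ... | false = ≈-trans (length-filter·1 P? xs) (≈-sym (+-identityˡ _))

  𝟙-¬ : {P : Set p} (P? : Dec P) → 𝟙 (¬? P?) ≈ 1# + - 1# * 𝟙 P?
  𝟙-¬ (true  Dec.because _) = ≈-sym (≈-trans (+-congˡ (*-identityʳ _)) (-‿inverseʳ 1#))
  𝟙-¬ (false Dec.because _) = ≈-sym (≈-trans (+-congˡ (zeroʳ _)) (+-identityʳ _))

  -- Expansion of the product of the factors 1 - [P x] over the entries x, a sublist recording the
  -- entries from which -[P x] is taken.
  inclusion–exclusion : {P : Pred A p} (P? : Decidable P) (xs : List A) →
    ∑ (sublists xs) (λ S → [-1]^ (length S) * 𝟙 (All.all? P? S)) ≈ 𝟙 (All.all? (¬? ∘ P?) xs)
  inclusion–exclusion P? []       = ≈-trans (+-identityʳ _) (*-identityˡ _)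
  inclusion–exclusion P? (x ∷ xs) = begin
    ∑ (sublists xs ++ map (x ∷_) (sublists xs)) term
      ≈⟨ ∑-++ (sublists xs) _ term ⟩
    ∑ (sublists xs) term + ∑ (map (x ∷_) (sublists xs)) term
      ≈⟨ +-congˡ (∑-map (x ∷_) (sublists xs) term) ⟩
    ∑ (sublists xs) term + ∑ (sublists xs) (λ S → - 1# * [-1]^ (length S) * 𝟙 (All.all? P? (x ∷ S)))
      ≈⟨ +-congˡ (∑-cong (sublists xs) (λ S → ≈-trans (*-congˡ (𝟙-× (P? x) (All.all? P? S))) (*-interchange _ _ _ _))) ⟩
    ∑ (sublists xs) term + ∑ (sublists xs) (λ S → - 1# * 𝟙 (P? x) * term S)
      ≈⟨ +-cong (≈-sym (*-identityˡ _)) (≈-sym (*-∑ _ (sublists xs) term)) ⟩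
    1# * ∑ (sublists xs) term + - 1# * 𝟙 (P? x) * ∑ (sublists xs) term
      ≈⟨ distribʳ _ _ _ ⟨
    (1# + - 1# * 𝟙 (P? x)) * ∑ (sublists xs) term
      ≈⟨ *-cong (≈-sym (𝟙-¬ (P? x))) (inclusion–exclusion P? xs) ⟩
    𝟙 (¬? (P? x)) * 𝟙 (All.all? (¬? ∘ P?) xs)
      ≈⟨ 𝟙-× (¬? (P? x)) (All.all? (¬? ∘ P?) xs) ⟨
    𝟙 (All.all? (¬? ∘ P?) (x ∷ xs))
      ∎
    where
    term = λ S → [-1]^ (length S) * 𝟙 (All.all? P? S)

  -- The chromatic functions of a digraph and of its underlying graph

  module _ (D : Digraph) where
    open Digraph D

    -- `α` goes through `mapWith∈` to supply the positivity of each part; projecting to `value`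
    -- discards these proofs and leaves an ordinary `map`.
    sizes-α : ∀ S → map value (α D S) ≡ map length (sortedComponents D S)
    sizes-α S = ≡.trans (map-mapWith∈ (sortedComponents D S) _ value) (mapWith∈≗map length (sortedComponents D S))

    powerSumProduct-α : ∀ S → powerSumProduct value (α D S) ≡ powerSumProduct length (sortedComponents D S)
    powerSumProduct-α S = ≡.trans (≡.sym (List.foldr-map _ value 1ˢ (α D S)))
      (≡.trans (cong (powerSumProduct id) (sizes-α S)) (List.foldr-map _ length 1ˢ (sortedComponents D S)))

    -- A term of the product of the power sums p_{|C|} is a choice of one colour per component, and
    -- `colouring` spreads it over the vertices without changing the monomial.
    φ-Ψᶜ-α : ∀ S e → φ (Ψᶜ (α D S)) e ≈
      ∑ (words (allFin (length e)) order) (λ w → 𝟙 (All.all? (monochromatic? w) S) * 𝟙 (monomial w ≟ᴹ e))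
    φ-Ψᶜ-α S e = begin
      φ (Ψᶜ (α D S)) e
        ≈⟨ φ-Ψᶜ (α D S) e ⟩
      powerSumProduct value (α D S) e
        ≈⟨ reflexive (cong (λ f → f e) (powerSumProduct-α S)) ⟩
      powerSumProduct length Cs e
        ≈⟨ powerSumProduct≈ length Cs e refl ⟩
      ∑ (words (allFin (length e)) (length Cs)) (λ d → 𝟙 (tabulate (content length Cs d) ≟ᴹ e))
        ≈⟨ ∑-cong (words (allFin (length e)) (length Cs)) (λ d → reflexive (cong (λ x → 𝟙 (x ≟ᴹ e))
             (≡.trans (List.tabulate-cong (λ i → ≡.sym (occurrences-colouring d i))) (≡.sym (monomial≡tabulate (colouring d)))))) ⟩
      ∑ (words (allFin (length e)) (length Cs)) (λ d → 𝟙 (monomial (colouring d) ≟ᴹ e))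
        ≈⟨ ∑-map colouring (words (allFin (length e)) (length Cs)) _ ⟨
      ∑ (map colouring (words (allFin (length e)) (length Cs))) (λ w → 𝟙 (monomial w ≟ᴹ e))
        ≈⟨ ∑-↭ _ colourings-↭ ⟩
      ∑ (filter (λ w → All.all? (monochromatic? w) S) (words (allFin (length e)) order)) (λ w → 𝟙 (monomial w ≟ᴹ e))
        ≈⟨ ∑-filter _ (words (allFin (length e)) order) _ ⟩
      ∑ (words (allFin (length e)) order) (λ w → 𝟙 (All.all? (monochromatic? w) S) * 𝟙 (monomial w ≟ᴹ e))
        ∎
      where
      Cs = sortedComponents D S
      open ComponentColourings S (Sort.sort-↭ (StrictTotalOrderProperties.decTotalOrder (▷-strictTotalOrder D)) (components S))

    -- An edge comes from an arc in one of the two directions, and having different colours is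
    -- symmetric, so testing the arcs tests all edges.
    𝟙-proper : ∀ {m} (w : Vec (Fin m) order) →
      𝟙 (All.all? (¬? ∘ monochromatic? w) (arcs D)) ≈ 𝟙 (proper? (underlying D) w)
    𝟙-proper w = 𝟙-⇔ (All.all? (¬? ∘ monochromatic? w) (arcs D)) (proper? (underlying D) w)
      (λ mono u v → [ All.lookup mono ∘ arc∈ , (λ vu → All.lookup mono (arc∈ vu) ∘ ≡.sym) ]′)
      (λ proper → All.tabulate λ {(u , v)} uv∈ → proper u v (inj₁ (proj₂ (∈-filter⁻ (λ (u , v) → u ⟶? v) {xs = cartesianProduct (allFin order) (allFin order)} uv∈))))
      where
      arc∈ : ∀ {u v} → u ⟶ v → (u , v) ∈ arcs D
      arc∈ {u} {v} = ∈-filter⁺ (λ (u , v) → u ⟶? v) (∈-cartesianProduct⁺ (∈-allFin u) (∈-allFin v))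

    X≈∑ : ∀ e → X (underlying D) e ≈
      ∑ (words (allFin (length e)) order) (λ w → 𝟙 (proper? (underlying D) w) * 𝟙 (monomial w ≟ᴹ e))
    X≈∑ e = ≈-trans
      (length-filter·1 (λ w → proper? (underlying D) w ×-dec (monomial w ≟ᴹ e)) (words (allFin (length e)) order))
      (∑-cong (words (allFin (length e)) order) (λ w → 𝟙-× (proper? (underlying D) w) (monomial w ≟ᴹ e)))

    χ𝐗≈X : ⟦ χ (𝐗 D) ⟧ ≈ˢ X (underlying D)
    χ𝐗≈X e = begin
      ⟦ χ (𝐗 D) ⟧ e
        ≈⟨ ⟦χ⟧≈φ (𝐗 D) e ⟩
      φ (𝐗 D) e
        ≈⟨ φ-∑ Ss (λ S → [-1]^ (length S) • Ψᶜ (α D S)) e ⟩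
      ∑ Ss (λ S → φ ([-1]^ (length S) • Ψᶜ (α D S)) e)
        ≈⟨ ∑-cong Ss (λ S → ≈-trans (φ-• _ (Ψᶜ (α D S)) e) (*-congˡ (φ-Ψᶜ-α S e))) ⟩
      ∑ Ss (λ S → [-1]^ (length S) * ∑ ws (λ w → 𝟙 (All.all? (monochromatic? w) S) * 𝟙 (monomial w ≟ᴹ e)))
        ≈⟨ ∑-cong Ss (λ S → ≈-trans (*-∑ _ ws _) (∑-cong ws (λ w → ≈-sym (*-assoc _ _ _)))) ⟩
      ∑ Ss (λ S → ∑ ws (λ w → [-1]^ (length S) * 𝟙 (All.all? (monochromatic? w) S) * 𝟙 (monomial w ≟ᴹ e)))
        -- With the colouring `w` fixed, its monomial is a common factor and the inner signed sum
        -- over arc sets is the one evaluated by `inclusion–exclusion`.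
        ≈⟨ ∑-swap Ss ws _ ⟩
      ∑ ws (λ w → ∑ Ss (λ S → [-1]^ (length S) * 𝟙 (All.all? (monochromatic? w) S) * 𝟙 (monomial w ≟ᴹ e)))
        ≈⟨ ∑-cong ws (λ w → ≈-sym (∑-* _ Ss _)) ⟩
      ∑ ws (λ w → ∑ Ss (λ S → [-1]^ (length S) * 𝟙 (All.all? (monochromatic? w) S)) * 𝟙 (monomial w ≟ᴹ e))
        ≈⟨ ∑-cong ws (λ w → *-congʳ (≈-trans (inclusion–exclusion (monochromatic? w) (arcs D)) (𝟙-proper w))) ⟩
      ∑ ws (λ w → 𝟙 (proper? (underlying D) w) * 𝟙 (monomial w ≟ᴹ e))
        ≈⟨ X≈∑ e ⟨
      X (underlying D) e
        ∎
      where
      Ss = sublists (arcs D)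
      ws = words (allFin (length e)) order

theorem2 : ∀ {c ℓ} (𝕜 : Field c ℓ) → CharacteristicZero 𝕜 → let open OverField 𝕜 in
    (D : Digraph) → ⟦ χ (𝐗 D) ⟧ ≈ˢ X (underlying D)
theorem2 𝕜 _ = χ𝐗≈X 𝕜
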